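{- Let $G$ be the graph on vertex set $\{0,1,\dots,9\}$ with the 17 edges $$\{0,1\},\{0,2\},\{0,3\},\{0,5\},\{1,5\},\{1,7\},\{2,3\},\{2,4\},\{2,6\},\{2,9\},\{3,4\},\{3,5\},\{3,6\},\{4,9\},\{5,7\},\{5,8\},\{6,9\},$$ and let $H$ be the graph on vertex set $\{0,1,\dots,9\}$ with the 16 edges $$\{0,1\},\{0,2\},\{0,3\},\{0,5\},\{1,5\},\{1,7\},\{2,3\},\{2,4\},\{2,5\},\{2,6\},\{2,9\},\{3,8\},\{4,9\},\{5,8\},\{6,9\},\{7,8\}.$$ Then for any finite connected graph $K$, any vertex $v \in V(K)$, and any $u \in \{0,1\}$, the graphs $GK(u,v)$ and $HK(u,v)$ are distance cospectral.
   Context: All graphs are finite, simple and connected. The distance matrix $D$ of a connected graph has rows and columns indexed by the vertices, with $(i,j)$ entry equal to the length of a shortest path between $i$ and $j$. Two connected graphs are distance cospectral if their distance matrices have the same multiset of eigenvalues. For graphs $G, K$ and vertices $u \in V(G)$, $v\in V(K)$, the graph $GK(u,v)$ is obtained from the disjoint union $G \cup K$ by identifying the vertices $u$ and $v$ into a single vertex. Similarly $HK(u,v)$ is obtained from $H\cup K$ by identifying $u \in V(H)$ with $v$. -}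

module Defs where

open import Data.Bool using (Bool; true; false; _∧_; _∨_; if_then_else_)
open import Data.Nat as ℕ using (ℕ; zero; suc; _≤_; _≡ᵇ_)
open import Data.Integer as ℤ using (ℤ; +_; -_)
open import Data.Fin using (Fin; zero; suc; toℕ; splitAt; punchIn; _≟_)
open import Data.List using (List; []; _∷_; map)
open import Data.Bool.ListAction using (any)
open import Data.Maybe using (Maybe; just; nothing)
open import Data.Product using (_×_; _,_; Σ)
open import Data.Sum using (inj₁; inj₂)
open import Relation.Nullary using (does)
open import Relation.Binary.PropositionalEquality using (_≡_)

Adjacency : ℕ → Set
Adjacency n = Fin n → Fin n → Bool

SymmetricAdj : ∀ {n} → Adjacency n → Set
SymmetricAdj {n} A = ∀ (i j : Fin n) → A i j ≡ A j i

IrreflexiveAdj : ∀ {n} → Adjacency n → Set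
IrreflexiveAdj {n} A = ∀ (i : Fin n) → A i i ≡ false

data Walk {n : ℕ} (A : Adjacency n) : Fin n → Fin n → ℕ → Set where
  stay : ∀ {i} → Walk A i i 0
  step : ∀ {i l j k} → A i l ≡ true → Walk A l j k → Walk A i j (suc k)

Connected : ∀ {n} → Adjacency n → Set
Connected {n} A = ∀ (i j : Fin n) → Σ ℕ (λ k → Walk A i j k)

IsDistanceMatrix : ∀ {n} → Adjacency n → (Fin n → Fin n → ℕ) → Set
IsDistanceMatrix {n} A D =
  ∀ (i j : Fin n) → Walk A i j (D i j) × (∀ k → Walk A i j k → D i j ≤ k)

-- Integer polynomials as coefficient lists (lowest degree first).

Poly : Set
Poly = List ℤ

_+P_ : Poly → Poly → Poly
[] +P q = q
(a ∷ p) +P [] = a ∷ p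
(a ∷ p) +P (b ∷ q) = (a ℤ.+ b) ∷ (p +P q)

scaleP : ℤ → Poly → Poly
scaleP c p = map (c ℤ.*_) p

_*P_ : Poly → Poly → Poly
[] *P q = []
(a ∷ p) *P q = scaleP a q +P (ℤ.0ℤ ∷ (p *P q))

negP : Poly → Poly
negP = map -_

coeff : ℕ → Poly → ℤ
coeff _ [] = ℤ.0ℤ
coeff zero (a ∷ p) = a
coeff (suc k) (a ∷ p) = coeff k p

_≈P_ : Poly → Poly → Set
p ≈P q = ∀ (k : ℕ) → coeff k p ≡ coeff k q

det : ∀ n → (Fin n → Fin n → Poly) → Poly
det zero M = ℤ.1ℤ ∷ []
det (suc n) M = expand (suc n) (λ x → x) true
  where
  term : Fin (suc n) → Poly
  term j = M zero j *P det n (λ r c → M (suc r) (punchIn j c))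
  expand : ∀ k → (Fin k → Fin (suc n)) → Bool → Poly
  expand zero col s = []
  expand (suc k) col s =
    (if s then term (col zero) else negP (term (col zero)))
      +P expand k (λ x → col (suc x)) (if s then false else true)

charPoly : ∀ {n} → (Fin n → Fin n → ℕ) → Poly
charPoly {n} D = det n (λ i j →
  if does (i ≟ j) then (- (+ D i j)) ∷ ℤ.1ℤ ∷ [] else (- (+ D i j)) ∷ [])

DistanceCospectral : ∀ {n} → Adjacency n → Adjacency n → Set
DistanceCospectral {n} A B =
  ∀ (DA DB : Fin n → Fin n → ℕ) → IsDistanceMatrix A DA → IsDistanceMatrix B DB →
  charPoly DA ≈P charPoly DB

fromEdges : List (ℕ × ℕ) → Adjacency 10
fromEdges es i j = any (λ { (a , b) →
  ((a ≡ᵇ toℕ i) ∧ (b ≡ᵇ toℕ j)) ∨ ((a ≡ᵇ toℕ j) ∧ (b ≡ᵇ toℕ i)) }) es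

edgesG : List (ℕ × ℕ)
edgesG = (0 , 1) ∷ (0 , 2) ∷ (0 , 3) ∷ (0 , 5) ∷ (1 , 5) ∷ (1 , 7) ∷ (2 , 3) ∷
         (2 , 4) ∷ (2 , 6) ∷ (2 , 9) ∷ (3 , 4) ∷ (3 , 5) ∷ (3 , 6) ∷ (4 , 9) ∷
         (5 , 7) ∷ (5 , 8) ∷ (6 , 9) ∷ []

edgesH : List (ℕ × ℕ)
edgesH = (0 , 1) ∷ (0 , 2) ∷ (0 , 3) ∷ (0 , 5) ∷ (1 , 5) ∷ (1 , 7) ∷ (2 , 3) ∷
         (2 , 4) ∷ (2 , 5) ∷ (2 , 6) ∷ (2 , 9) ∷ (3 , 8) ∷ (4 , 9) ∷ (5 , 8) ∷
         (6 , 9) ∷ (7 , 8) ∷ []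

G : Adjacency 10
G = fromEdges edgesG

H : Adjacency 10
H = fromEdges edgesH

-- Coalescence: identify u ∈ V(B) (B on Fin 10) with v ∈ V(K) (K on Fin (suc m)).
-- Vertex set Fin (10 + m): the first 10 are the vertices of B (u is the merged
-- vertex), the remaining m are the vertices of K other than v (via punchIn v).

private
  bothAdj : ∀ {n} → Adjacency n → Maybe (Fin n) → Maybe (Fin n) → Bool
  bothAdj A (just x) (just y) = A x y
  bothAdj A _ _ = false

glue : ∀ {m} → Adjacency 10 → Fin 10 → Adjacency (suc m) → Fin (suc m) →
       Adjacency (10 ℕ.+ m)
glue {m} B u K v x y = bothAdj B (bPart x) (bPart y) ∨ bothAdj K (kPart x) (kPart y)
  where
  bPart : Fin (10 ℕ.+ m) → Maybe (Fin 10)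
  bPart z with splitAt 10 z
  ... | inj₁ a = just a
  ... | inj₂ _ = nothing
  kPart : Fin (10 ℕ.+ m) → Maybe (Fin (suc m))
  kPart z with splitAt 10 z
  ... | inj₁ a = if does (a ≟ u) then just v else nothing
  ... | inj₂ b = just (punchIn v b)

module Submission where

-- Every vertex of a coalescence lies over a vertex ρ of the ten-vertex graph
-- and a vertex φ of K, and distances add: D x y = d (ρ x) (ρ y) + dK (φ x) (φ y).
-- There is an integer matrix S with Sᵀ S = 49 I and S D(G) = D(H) S, all of whose
-- row and column sums are 7, and whose rows and columns 0 and 1 are 7 times those
-- of the identity.  Hence T = diag(S , 7 I) satisfies T D(GK) = D(HK) T whenever
-- u ∈ {0 , 1}, and det T ≠ 0 cancels from det T det(z - D(GK)) = det(z - D(HK)) det T.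
-- This is done for every integer z, and two polynomials with the same values at
-- all integers are equal.

open import Defs
open import Agda.Builtin.Equality.Erase using (primEraseEquality)
open import Data.Bool using (Bool; true; false; if_then_else_)
open import Data.Bool.Properties using (∨-zeroʳ) renaming (_≟_ to _≟ᵇ_)
open import Data.Fin using (Fin; zero; suc; toℕ; punchIn; punchOut; pinch; splitAt; _↑ˡ_; _↑ʳ_; _≟_)
open import Data.Fin.Properties using (all?; any?; punchIn-punchOut; punchInᵢ≢i; punchOut-cong; punchOut-punchIn; splitAt-↑ˡ; splitAt-↑ʳ; join-splitAt)
open import Data.Integer as ℤ using (ℤ; 0ℤ; 1ℤ; -1ℤ; +_; _+_; _*_; _-_; -_)
import Data.Integer.Properties as ℤₚ
open import Data.Integer.Tactic.RingSolver using (solve-∀)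
open import Data.List using ([]; _∷_)
open import Data.Nat as ℕ using (ℕ; zero; suc; _≤_; _<_; s≤s; _⊔_)
open import Data.Nat.Divisibility using (divides; ∣⇒≤)
import Data.Nat.Properties as ℕₚ
open import Data.Product using (Σ; ∃; _×_; _,_; proj₁; proj₂)
open import Data.Sum using (_⊎_; inj₁; inj₂; [_,_]′)
open import Data.Unit using (⊤; tt)
open import Data.Vec using (Vec; []; _∷_; lookup; map; tabulate)
open import Data.Vec.Membership.Propositional using (_∈_)
open import Data.Vec.Properties using (tabulate-∘; map-∘)
open import Data.Vec.Relation.Binary.Pointwise.Inductive as Pointwise using (Pointwise; []; _∷_)
open import Data.Vec.Relation.Unary.Any using (here; there)
open import Algebra.Properties.Semiring.Sum ℤₚ.+-*-semiring using (sum; sum-cong-≗; ∑-distrib-+; *-distribˡ-sum; *-distribʳ-sum)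
open import Function using (_∘_; id; const)
open import Relation.Binary.PropositionalEquality using (_≡_; _≢_; _≗_; refl; sym; trans; cong; cong₂; subst; subst₂; module ≡-Reasoning)
open import Relation.Nullary using (Dec; yes; no; does; contradiction)
open import Relation.Nullary.Decidable using (from-yes; toWitness; True; dec-true; _×-dec_; _⊎-dec_; _→-dec_)
open import Tactic.Cong using (cong!)
open ≡-Reasoning

-- Determinants over ℤ

-- For every `K`, the distance matrix of the coalescence is that of the ten-vertex graph plus a
-- constant on the ten old vertices, and involves only row and column `u` of it elsewhere, again
-- plus constants that depend on `K`. Equal row and column sums carry the constants through `S`; the
-- rows and columns that `S` merely scales carry row and column `u`. So one matrix `S` serves all
-- `K` and `v`. The factor 7 clears the denominators of a rational orthogonal matrix and keeps the
-- whole argument in ℤ. A `Poly` is a coefficient list, and ring laws hold for such lists only up to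
-- trailing zeros. Integer values turn them into honest equations in ℤ, where nonzero factors
-- cancel. Multiplicativity of the determinant comes from uniqueness: an alternating function of `n`
-- rows of length `n` is the determinant times its value at the unit rows.

alt : ∀ {n} → (Fin n → ℤ) → ℤ
alt {zero}  f = 0ℤ
alt {suc n} f = f zero - alt (f ∘ suc)

alt-cong : ∀ {n} {f g : Fin n → ℤ} → f ≗ g → alt f ≡ alt g
alt-cong {zero}  e = refl
alt-cong {suc n} e = cong₂ _-_ (e zero) (alt-cong (e ∘ suc))

alt-linear : ∀ {n} c (f g : Fin n → ℤ) → alt (λ j → c * f j + g j) ≡ c * alt f + alt g
alt-linear {zero}  c f g = lemma c
  where
  lemma : ∀ c → 0ℤ ≡ c * 0ℤ + 0ℤ
  lemma = solve-∀
alt-linear {suc n} c f g =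
  trans (cong (_-_ (c * f zero + g zero)) (alt-linear c (f ∘ suc) (g ∘ suc)))
    (lemma c (f zero) (g zero) (alt (f ∘ suc)) (alt (g ∘ suc)))
  where
  lemma : ∀ c f g a b → c * f + g - (c * a + b) ≡ c * (f - a) + (g - b)
  lemma = solve-∀

alt-zero : ∀ {n} {f : Fin n → ℤ} → (∀ j → f j ≡ 0ℤ) → alt f ≡ 0ℤ
alt-zero {zero}  e = refl
alt-zero {suc n} e = cong₂ _-_ (e zero) (alt-zero (e ∘ suc))

alt-sub : ∀ {n} (f g : Fin n → ℤ) → alt (λ j → f j - g j) ≡ alt f - alt g
alt-sub {zero}  f g = refl
alt-sub {suc n} f g =
  trans (cong (_-_ (f zero - g zero)) (alt-sub (f ∘ suc) (g ∘ suc)))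
    (lemma (f zero) (g zero) (alt (f ∘ suc)) (alt (g ∘ suc)))
  where
  lemma : ∀ f g a b → f - g - (a - b) ≡ f - a - (g - b)
  lemma = solve-∀

-- (j , k) and (punchIn j k , pinch k j) are the two ways to delete the same
-- pair of columns, and they come with opposite signs.
alt-alt : ∀ {n} (h : Fin (suc n) → Fin n → ℤ) →
          (∀ j k → h j k ≡ h (punchIn j k) (pinch k j)) →
          alt (λ j → alt (h j)) ≡ 0ℤ
alt-alt {zero}  h e = refl
alt-alt {suc n} h e = begin
  alt (h zero) - alt (λ j → h (suc j) zero - alt (h (suc j) ∘ suc))
    ≡⟨ cong (_-_ (alt (h zero))) (alt-sub (λ j → h (suc j) zero) (λ j → alt (h (suc j) ∘ suc))) ⟩
  alt (h zero) - (alt (λ j → h (suc j) zero) - alt (λ j → alt (h (suc j) ∘ suc)))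
    ≡⟨ cong₂ (λ a b → alt (h zero) - (a - b))
         (alt-cong (λ j → e (suc j) zero))
         (alt-alt (λ j k → h (suc j) (suc k)) (λ j k → e (suc j) (suc k))) ⟩
  alt (h zero) - (alt (h zero) - 0ℤ)
    ≡⟨ lemma (alt (h zero)) ⟩
  0ℤ ∎
  where
  lemma : ∀ a → a - (a - 0ℤ) ≡ 0ℤ
  lemma = solve-∀

punchIn-swap : ∀ {n} (j : Fin (suc (suc n))) (k : Fin (suc n)) (c : Fin n) →
               punchIn j (punchIn k c) ≡ punchIn (punchIn j k) (punchIn (pinch k j) c)
punchIn-swap zero    k       c       = refl
punchIn-swap (suc j) zero    c       = refl
punchIn-swap (suc j) (suc k) zero    = refl
punchIn-swap (suc j) (suc k) (suc c) = cong suc (punchIn-swap j k c)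

punchIn-pinch : ∀ {n} (j : Fin (suc (suc n))) (k : Fin (suc n)) → punchIn (punchIn j k) (pinch k j) ≡ j
punchIn-pinch zero            k       = refl
punchIn-pinch (suc j)         zero    = refl
punchIn-pinch {suc n} (suc j) (suc k) = cong suc (punchIn-pinch j k)
punchIn-pinch {zero} (suc zero) (suc ())

-- Alternating functions of rows

Row : ℕ → Set
Row m = Fin m → ℤ

infix 6 _·_⊕_
_·_⊕_ : ∀ {m} → ℤ → Row m → Row m → Row m
(c · r ⊕ s) j = c * r j + s j

-- Rows are functions and are compared only pointwise, so respect for `≗` has to be part of
-- linearity.
record Linear {m} (L : Row m → ℤ) : Set where
  field
    ext : ∀ {r s} → r ≗ s → L r ≡ L s
    lin : ∀ c r s → L (c · r ⊕ s) ≡ c * L r + L s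

  zeros : L (λ _ → 0ℤ) ≡ 0ℤ
  -- `-1ℤ * 0ℤ + 0ℤ` computes to `0ℤ`, so the zero row is its own combination with coefficient
  -- `-1ℤ`, and the two values of `L` cancel.
  zeros = trans (lin -1ℤ (λ _ → 0ℤ) (λ _ → 0ℤ)) (lemma (L (λ _ → 0ℤ)))
    where
    lemma : ∀ a → -1ℤ * a + a ≡ 0ℤ
    lemma = solve-∀

open Linear

VanishesOnRepeat : ∀ {m} n → (Vec (Row m) (suc n) → ℤ) → Set
VanishesOnRepeat zero    F = ⊤
VanishesOnRepeat (suc n) F = ∀ r A → F (r ∷ r ∷ A) ≡ 0ℤ

-- The recursion on rows matches expansion along the first row. It asks for vanishing on equal
-- neighbours only; repetitions at a distance are reached by swaps in `alternating-∈`.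
Alternating : ∀ {m} n → (Vec (Row m) n → ℤ) → Set
Alternating zero    F = ⊤
Alternating (suc n) F =
  (∀ A → Linear (λ r → F (r ∷ A))) × (∀ r → Alternating n (λ A → F (r ∷ A))) × VanishesOnRepeat n F

alternating-ext : ∀ {m} n {F : Vec (Row m) n → ℤ} → Alternating n F →
                  ∀ {A B} → Pointwise _≗_ A B → F A ≡ F B
alternating-ext zero    _             []      = refl
alternating-ext (suc n) (l , t , _) {r ∷ A} {s ∷ B} (e ∷ p) =
  trans (ext (l A) e) (alternating-ext n (t s) p)

-- Polarisation: the value at the doubled row `r + s` vanishes, and expanding it leaves the two
-- mixed terms.
alternating-swap : ∀ {m} n {F : Vec (Row m) (suc (suc n)) → ℤ} → Alternating (suc (suc n)) F →
                   ∀ r s A → F (r ∷ s ∷ A) ≡ - F (s ∷ r ∷ A)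
alternating-swap n {F} (l , t , v) r s A = begin
  F (r ∷ s ∷ A)
    ≡⟨ lemma (F (r ∷ r ∷ A)) (F (r ∷ s ∷ A)) (F (s ∷ r ∷ A)) (F (s ∷ s ∷ A)) ⟩
  (1ℤ * (1ℤ * F (r ∷ r ∷ A) + F (r ∷ s ∷ A)) + (1ℤ * F (s ∷ r ∷ A) + F (s ∷ s ∷ A)))
    - F (s ∷ r ∷ A) - F (r ∷ r ∷ A) - F (s ∷ s ∷ A)
    ≡⟨ cong₂ _-_ (cong₂ _-_ (cong (_- F (s ∷ r ∷ A)) expansion) (v r A)) (v s A) ⟩
  0ℤ - F (s ∷ r ∷ A) - 0ℤ - 0ℤ
    ≡⟨ lemma′ (F (s ∷ r ∷ A)) ⟩
  - F (s ∷ r ∷ A) ∎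
  where
  u = 1ℤ · r ⊕ s
  lemma : ∀ a b c d → b ≡ (1ℤ * (1ℤ * a + b) + (1ℤ * c + d)) - c - a - d
  lemma = solve-∀
  lemma′ : ∀ a → 0ℤ - a - 0ℤ - 0ℤ ≡ - a
  lemma′ = solve-∀
  expansion : 1ℤ * (1ℤ * F (r ∷ r ∷ A) + F (r ∷ s ∷ A)) + (1ℤ * F (s ∷ r ∷ A) + F (s ∷ s ∷ A)) ≡ 0ℤ
  expansion = begin
    _ ≡⟨ cong₂ (λ a b → 1ℤ * a + b) (lin (proj₁ (t r) A) 1ℤ r s) (lin (proj₁ (t s) A) 1ℤ r s) ⟨
    1ℤ * F (r ∷ u ∷ A) + F (s ∷ u ∷ A) ≡⟨ lin (l (u ∷ A)) 1ℤ r s ⟨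
    F (u ∷ u ∷ A) ≡⟨ v u A ⟩
    0ℤ ∎

-- Adjacent swaps carry the head towards its copy, each at the cost of a sign.
alternating-∈ : ∀ {m} n {F : Vec (Row m) (suc n) → ℤ} → Alternating (suc n) F →
                ∀ {a A} → a ∈ A → F (a ∷ A) ≡ 0ℤ
alternating-∈ (suc n) (_ , _ , v) {a} {b ∷ A} (here refl) = v a A
alternating-∈ (suc n) {F} F-alt@(_ , t , _) {a} {b ∷ A} (there p) =
  trans (alternating-swap n {F} F-alt a b A) (cong -_ (alternating-∈ n (t b) p))

-- Row elimination: multiples of `a` may be removed from every row when `F` vanishes as soon as `a`
-- occurs. With `a` a unit row this clears a column.
alternating-reduce : ∀ {m} n {F : Vec (Row m) n → ℤ} → Alternating n F →
                     ∀ a → (∀ {A} → a ∈ A → F A ≡ 0ℤ) →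
                     (coef : Row m → ℤ) (rest : Row m → Row m) → (∀ r → r ≗ coef r · a ⊕ rest r) →
                     ∀ A → F A ≡ F (map rest A)
alternating-reduce zero    F-alt a kill coef rest split [] = refl
alternating-reduce (suc n) {F} (l , t , _) a kill coef rest split (r ∷ A) = begin
  F (r ∷ A)                              ≡⟨ ext (l A) (split r) ⟩
  F (coef r · a ⊕ rest r ∷ A)            ≡⟨ lin (l A) (coef r) a (rest r) ⟩
  coef r * F (a ∷ A) + F (rest r ∷ A)    ≡⟨ cong (λ z → coef r * z + F (rest r ∷ A)) (kill (here refl)) ⟩
  coef r * 0ℤ + F (rest r ∷ A)           ≡⟨ lemma (coef r) (F (rest r ∷ A)) ⟩
  F (rest r ∷ A)
    ≡⟨ alternating-reduce n (t (rest r)) a (kill ∘ there) coef rest split A ⟩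
  F (rest r ∷ map rest A)                ∎
  where
  lemma : ∀ c x → c * 0ℤ + x ≡ x
  lemma = solve-∀

record LinearMap {m k} (φ : Row m → Row k) : Set where
  field
    ext : ∀ {r s} → r ≗ s → φ r ≗ φ s
    lin : ∀ c r s → φ (c · r ⊕ s) ≗ c · φ r ⊕ φ s

alternating-map : ∀ {m k} {φ : Row m → Row k} → LinearMap φ →
                  ∀ n {F : Vec (Row k) n → ℤ} → Alternating n F → Alternating n (F ∘ map φ)
alternating-map φ-lin zero    F-alt = tt
alternating-map {φ = φ} φ-lin (suc n) {F} (l , t , v) =
  (λ A → record
    { ext = λ e → ext (l (map φ A)) (LinearMap.ext φ-lin e)
    ; lin = λ c r s → trans (ext (l (map φ A)) (LinearMap.lin φ-lin c r s)) (lin (l (map φ A)) c (φ r) (φ s))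
    }) ,
  (λ r → alternating-map φ-lin n (t (φ r))) ,
  repeat n v
  where
  repeat : ∀ n {F} → VanishesOnRepeat n F → VanishesOnRepeat n (F ∘ map φ)
  repeat zero    v     = tt
  repeat (suc n) v r A = v (φ r) (map φ A)

alternating-alt : ∀ {m k} n {F : Fin k → Vec (Row m) n → ℤ} (c : Fin k → ℤ) →
                  (∀ j → Alternating n (F j)) → Alternating n (λ A → alt (λ j → c j * F j A))
alternating-alt zero    c F-alt = tt
alternating-alt {m} {k} (suc n) {F} c F-alt =
  (λ A → record
    { ext = λ e → alt-cong (λ j → cong (c j *_) (ext (proj₁ (F-alt j) A) e))
    ; lin = λ d r s → trans
        (alt-cong (λ j → trans (cong (c j *_) (lin (proj₁ (F-alt j) A) d r s)) (lemma (c j) d (F j (r ∷ A)) (F j (s ∷ A)))))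
        (alt-linear d (λ j → c j * F j (r ∷ A)) (λ j → c j * F j (s ∷ A)))
    }) ,
  (λ r → alternating-alt n c (λ j → proj₁ (proj₂ (F-alt j)) r)) ,
  repeat n (λ j → proj₂ (proj₂ (F-alt j)))
  where
  lemma : ∀ c d a b → c * (d * a + b) ≡ d * (c * a) + c * b
  lemma = solve-∀
  repeat : ∀ n {F : Fin k → Vec (Row m) (suc n) → ℤ} → (∀ j → VanishesOnRepeat n (F j)) →
           VanishesOnRepeat n (λ A → alt (λ j → c j * F j A))
  repeat zero    v     = tt
  repeat (suc n) v r A = alt-zero (λ j → trans (cong (c j *_) (v j r A)) (ℤₚ.*-zeroʳ (c j)))

-- The determinant by expansion along the first row

delete : ∀ {m} → Fin (suc m) → Row (suc m) → Row m
delete j r = r ∘ punchIn j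

delete-linear : ∀ {m} (j : Fin (suc m)) → LinearMap (delete j)
delete-linear j = record { ext = λ e → e ∘ punchIn j ; lin = λ c r s k → refl }

-- The expansion of `det`, with its signs supplied by `alt` and the matrix given as a vector of
-- rows, the form on which `Alternating` recurses.
detℤ : ∀ n → Vec (Row n) n → ℤ
detℤ zero    A       = 1ℤ
detℤ (suc n) (r ∷ A) = alt (λ j → r j * detℤ n (map (delete j) A))

alt-factor : ∀ {n} c (f : Fin n → ℤ) → c * alt f ≡ alt (λ j → c * f j)
alt-factor {zero} c f = ℤₚ.*-zeroʳ c
alt-factor {suc n} c f = trans (lemma c (f zero) (alt (f ∘ suc))) (cong (_-_ (c * f zero)) (alt-factor c (f ∘ suc)))
  where
  lemma : ∀ c a b → c * (a - b) ≡ c * a - c * b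
  lemma = solve-∀

-- The substance is the case of two equal leading rows: expanding twice sums over ordered pairs of
-- distinct columns, and the two orders of a pair cancel by `alt-alt`.
det-alternating : ∀ n → Alternating n (detℤ n)
det-alternating zero    = tt
det-alternating (suc n) =
  (λ A → record
    { ext = λ e → alt-cong (λ j → cong (_* detℤ n (map (delete j) A)) (e j))
    ; lin = λ c r s → let D = λ j → detℤ n (map (delete j) A) in
        trans (alt-cong (λ j → lemma c (r j) (s j) (D j))) (alt-linear c (λ j → r j * D j) (λ j → s j * D j))
    }) ,
  (λ r → alternating-alt n r (λ j → alternating-map (delete-linear j) n (det-alternating n))) ,
  repeat n
  where
  lemma : ∀ c r s d → (c * r + s) * d ≡ c * (r * d) + s * d
  lemma = solve-∀
  lemma′ : ∀ a b d → a * (b * d) ≡ b * (a * d)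
  lemma′ = solve-∀
  repeat : ∀ n → VanishesOnRepeat n (detℤ (suc n))
  repeat zero        = tt
  repeat (suc n) r A = 
      trans (alt-cong (λ j → alt-factor (r j) (λ k → r (punchIn j k) * detℤ n (map (delete k) (map (delete j) A)))))
            (alt-alt h symmetric)
    where
    h : Fin (suc (suc n)) → Fin (suc n) → ℤ
    h j k = r j * (r (punchIn j k) * detℤ n (map (delete k) (map (delete j) A)))
    columns : ∀ {l} j k (B : Vec (Row (suc (suc n))) l) →
              Pointwise _≗_ (map (delete k) (map (delete j) B))
                            (map (delete (pinch k j)) (map (delete (punchIn j k)) B))
    columns j k []      = []
    columns j k (b ∷ B) = (λ c → cong b (punchIn-swap j k c)) ∷ columns j k B
    symmetric : ∀ j k → h j k ≡ h (punchIn j k) (pinch k j)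
    symmetric j k = begin
      r j * (r (punchIn j k) * detℤ n (map (delete k) (map (delete j) A)))
        ≡⟨ lemma′ (r j) (r (punchIn j k)) (detℤ n (map (delete k) (map (delete j) A))) ⟩
      r (punchIn j k) * (r j * detℤ n (map (delete k) (map (delete j) A)))
        ≡⟨ cong₂ (λ a b → r (punchIn j k) * (a * b))
             (cong r (sym (punchIn-pinch j k)))
             (alternating-ext n (det-alternating n) (columns j k A)) ⟩
      h (punchIn j k) (pinch k j) ∎

-- Uniqueness of alternating functions

δ : ∀ {m} → Fin m → Row m
δ zero    zero    = 1ℤ
δ zero    (suc j) = 0ℤ
δ (suc i) zero    = 0ℤ
δ (suc i) (suc j) = δ i j

sign : ∀ {m} → Fin m → ℤ
sign zero    = 1ℤ
sign (suc j) = - sign j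

-- A linear form is determined by its values on the unit rows. The separate factor `c` lets the
-- induction absorb the sign change from `sign j` to `sign (suc j)`.
linear-expand : ∀ {m} {L : Row m → ℤ} → Linear L → (w : Fin m → ℤ) (c : ℤ) →
                (∀ j → L (δ j) ≡ sign j * w j * c) → ∀ r → L r ≡ alt (λ j → r j * w j) * c
linear-expand {zero}      L-lin w c e r = trans (ext L-lin (λ ())) (zeros L-lin)
linear-expand {suc m} {L} L-lin w c e r = begin
  L r
    ≡⟨ ext L-lin split ⟩
  L (r zero · δ zero ⊕ shift (r ∘ suc))
    ≡⟨ lin L-lin (r zero) (δ zero) (shift (r ∘ suc)) ⟩
  r zero * L (δ zero) + L (shift (r ∘ suc))
    ≡⟨ cong₂ (λ a b → r zero * a + b) (e zero) (linear-expand tail (w ∘ suc) (- c) e′ (r ∘ suc)) ⟩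
  r zero * (1ℤ * w zero * c) + alt (λ j → r (suc j) * w (suc j)) * - c
    ≡⟨ lemma (r zero) (w zero) c (alt (λ j → r (suc j) * w (suc j))) ⟩
  (r zero * w zero - alt (λ j → r (suc j) * w (suc j))) * c ∎
  where
  shift : Row m → Row (suc m)
  shift s zero    = 0ℤ
  shift s (suc j) = s j
  head : ∀ a → a ≡ a * 1ℤ + 0ℤ
  head = solve-∀
  rest : ∀ a b → b ≡ a * 0ℤ + b
  rest = solve-∀
  split : r ≗ r zero · δ zero ⊕ shift (r ∘ suc)
  split zero    = head (r zero)
  split (suc j) = rest (r zero) (r (suc j))
  shift-ext : ∀ {s t} → s ≗ t → shift s ≗ shift t
  shift-ext e zero    = refl
  shift-ext e (suc j) = e j
  shift-lin : ∀ c s t → shift (c · s ⊕ t) ≗ c · shift s ⊕ shift t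
  shift-lin c s t zero    = rest c 0ℤ
  shift-lin c s t (suc j) = refl
  tail : Linear (L ∘ shift)
  tail = record
    { ext = λ e → ext L-lin (shift-ext e)
    ; lin = λ c s t → trans (ext L-lin (shift-lin c s t)) (lin L-lin c (shift s) (shift t))
    }
  δ-shift : ∀ j → shift (δ j) ≗ δ (suc j)
  δ-shift j zero    = refl
  δ-shift j (suc k) = refl
  signs : ∀ s w c → - s * w * c ≡ s * w * - c
  signs = solve-∀
  e′ : ∀ j → L (shift (δ j)) ≡ sign j * w (suc j) * - c
  e′ j = trans (ext L-lin (δ-shift j)) (trans (e (suc j)) (signs (sign j) (w (suc j)) c))
  lemma : ∀ r w c a → r * (1ℤ * w * c) + a * - c ≡ (r * w - a) * c
  lemma = solve-∀

insertZero : ∀ {m} → Fin (suc m) → Row m → Row (suc m)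
insertZero zero            r zero    = 0ℤ
insertZero zero            r (suc k) = r k
insertZero {suc m} (suc j) r zero    = r zero
insertZero {suc m} (suc j) r (suc k) = insertZero j (r ∘ suc) k

insertZero-linear : ∀ {m} (j : Fin (suc m)) → LinearMap (insertZero j)
insertZero-linear j = record { ext = insert-ext j ; lin = insert-lin j }
  where
  insert-ext : ∀ {m} (j : Fin (suc m)) {r s : Row m} → r ≗ s → insertZero j r ≗ insertZero j s
  insert-ext zero            e zero    = refl
  insert-ext zero            e (suc k) = e k
  insert-ext {suc m} (suc j) e zero    = e zero
  insert-ext {suc m} (suc j) e (suc k) = insert-ext j (e ∘ suc) k
  lemma : ∀ c → 0ℤ ≡ c * 0ℤ + 0ℤ
  lemma = solve-∀
  insert-lin : ∀ {m} (j : Fin (suc m)) c (r s : Row m) →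
               insertZero j (c · r ⊕ s) ≗ c · insertZero j r ⊕ insertZero j s
  insert-lin zero            c r s zero    = lemma c
  insert-lin zero            c r s (suc k) = refl
  insert-lin {suc m} (suc j) c r s zero    = refl
  insert-lin {suc m} (suc j) c r s (suc k) = insert-lin j c (r ∘ suc) (s ∘ suc) k

split-column : ∀ {m} (j : Fin (suc m)) (r : Row (suc m)) → r ≗ r j · δ j ⊕ insertZero j (delete j r)
split-column zero r zero = lemma (r zero)
  where
  lemma : ∀ a → a ≡ a * 1ℤ + 0ℤ
  lemma = solve-∀
split-column zero r (suc k) = lemma (r zero) _
  where
  lemma : ∀ a b → b ≡ a * 0ℤ + b
  lemma = solve-∀
split-column {suc m} (suc j) r zero = lemma (r (suc j)) _
  where
  lemma : ∀ a b → b ≡ a * 0ℤ + b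
  lemma = solve-∀
split-column {suc m} (suc j) r (suc k) = split-column j (r ∘ suc) k

insertZero-δ : ∀ {m} (j : Fin (suc m)) (k : Fin m) → insertZero j (δ k) ≗ δ (punchIn j k)
insertZero-δ zero    k       zero    = refl
insertZero-δ zero    k       (suc i) = refl
insertZero-δ (suc j) zero    zero    = refl
insertZero-δ {suc m} (suc j) zero (suc i) = zeros-inserted j i
  where
  zeros-inserted : ∀ {m} (j i : Fin (suc m)) → insertZero j (λ _ → 0ℤ) i ≡ 0ℤ
  zeros-inserted zero            zero    = refl
  zeros-inserted zero            (suc i) = refl
  zeros-inserted {suc m} (suc j) zero    = refl
  zeros-inserted {suc m} (suc j) (suc i) = zeros-inserted j i
insertZero-δ (suc j) (suc k) zero    = refl
insertZero-δ (suc j) (suc k) (suc i) = insertZero-δ j k i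

-- Row `j` reaches the front by `j` adjacent swaps, whence `sign j`.
alternating-cycle : ∀ {m} n {F : Vec (Row m) (suc n) → ℤ} → Alternating (suc n) F →
                    ∀ (Q : Fin (suc n) → Row m) j →
                    F (Q j ∷ tabulate (Q ∘ punchIn j)) ≡ sign j * F (tabulate Q)
alternating-cycle n F-alt Q zero = sym (ℤₚ.*-identityˡ _)
alternating-cycle (suc n) {F} F-alt@(_ , t , _) Q (suc j) = begin
  F (Q (suc j) ∷ Q zero ∷ tabulate (Q ∘ suc ∘ punchIn j))
    ≡⟨ alternating-swap n {F} F-alt (Q (suc j)) (Q zero) (tabulate (Q ∘ suc ∘ punchIn j)) ⟩
  - F (Q zero ∷ Q (suc j) ∷ tabulate (Q ∘ suc ∘ punchIn j))
    ≡⟨ cong -_ (alternating-cycle n (t (Q zero)) (Q ∘ suc) j) ⟩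
  - (sign j * F (tabulate Q))
    ≡⟨ ℤₚ.neg-distribˡ-* (sign j) (F (tabulate Q)) ⟩
  - sign j * F (tabulate Q) ∎

-- By linearity the first row may be taken to be a unit row `δ j`. Then column `j` of the other rows
-- can be cleared, and what is left is an alternating function of the minor, to which induction
-- applies.
alternating-det : ∀ n {F : Vec (Row n) n → ℤ} → Alternating n F → ∀ A → F A ≡ detℤ n A * F (tabulate δ)
alternating-det zero    F-alt [] = sym (ℤₚ.*-identityˡ _)
alternating-det (suc n) {F} F-alt@(l , t , _) (r ∷ A) =
  linear-expand (l A) (λ j → detℤ n (map (delete j) A)) (F (tabulate δ)) minor r
  where
  minor : ∀ j → F (δ j ∷ A) ≡ sign j * detℤ n (map (delete j) A) * F (tabulate δ)
  minor j = begin
    F (δ j ∷ A)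
      -- `δ j` already stands in front, so any tail that contains it gives a repeated row.
      ≡⟨ alternating-reduce n (t (δ j)) (δ j) (alternating-∈ n F-alt)
           (λ s → s j) (insertZero j ∘ delete j) (split-column j) A ⟩
    F (δ j ∷ map (insertZero j ∘ delete j) A)
      ≡⟨ cong (λ B → F (δ j ∷ B)) (map-∘ (insertZero j) (delete j) A) ⟩
    F (δ j ∷ map (insertZero j) (map (delete j) A))
      -- The induction is on `F (δ j ∷ map (insertZero j) B)` as a function of `B`.
      ≡⟨ alternating-det n (alternating-map (insertZero-linear j) n (t (δ j))) (map (delete j) A) ⟩
    detℤ n (map (delete j) A) * F (δ j ∷ map (insertZero j) (tabulate δ))
      ≡⟨ cong (λ B → detℤ n (map (delete j) A) * F (δ j ∷ B)) (tabulate-∘ (insertZero j) δ) ⟨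
    detℤ n (map (delete j) A) * F (δ j ∷ tabulate (insertZero j ∘ δ))
      ≡⟨ cong (detℤ n (map (delete j) A) *_)
           (alternating-ext n (t (δ j)) (Pointwise.tabulate⁺ (insertZero-δ j))) ⟩
    detℤ n (map (delete j) A) * F (δ j ∷ tabulate (δ ∘ punchIn j))
      ≡⟨ cong (detℤ n (map (delete j) A) *_) (alternating-cycle n F-alt δ j) ⟩
    detℤ n (map (delete j) A) * (sign j * F (tabulate δ))
      ≡⟨ lemma (detℤ n (map (delete j) A)) (sign j) (F (tabulate δ)) ⟩
    sign j * detℤ n (map (delete j) A) * F (tabulate δ) ∎
    where
    lemma : ∀ a b c → a * (b * c) ≡ b * a * c
    lemma = solve-∀

-- Determinants of products

Square : ℕ → Set
Square n = Fin n → Row n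

Det : ∀ {n} → Square n → ℤ
Det {n} M = detℤ n (tabulate M)

Det-cong : ∀ {n} {M N : Square n} → (∀ i → M i ≗ N i) → Det M ≡ Det N
Det-cong {n} e = alternating-ext n (det-alternating n) (Pointwise.tabulate⁺ e)

infixl 7 _⊗_
_⊗_ : ∀ {n} → Square n → Square n → Square n
(M ⊗ N) i j = sum (λ k → M i k * N k j)

sum-δ : ∀ {n} (i : Fin n) (f : Fin n → ℤ) → sum (λ k → δ i k * f k) ≡ f i
sum-δ zero f = begin
  1ℤ * f zero + sum (λ k → 0ℤ * f (suc k)) ≡⟨ cong (_+_ (1ℤ * f zero)) (*-distribˡ-sum 0ℤ (f ∘ suc)) ⟨
  1ℤ * f zero + 0ℤ * sum (f ∘ suc)         ≡⟨ lemma (f zero) (sum (f ∘ suc)) ⟩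
  f zero                                   ∎
  where
  lemma : ∀ a b → 1ℤ * a + 0ℤ * b ≡ a
  lemma = solve-∀
sum-δ (suc i) f = trans (ℤₚ.+-identityˡ _) (sum-δ i (f ∘ suc))

-- Multiplication by `N` acts linearly on each row, so the determinant of the product is alternating
-- in the rows of `M`; its value at the unit rows is `Det N`.
Det-⊗ : ∀ {n} (M N : Square n) → Det (M ⊗ N) ≡ Det M * Det N
Det-⊗ {n} M N = begin
  detℤ n (tabulate (times ∘ M))                   ≡⟨ cong (detℤ n) (tabulate-∘ times M) ⟩
  detℤ n (map times (tabulate M))
    ≡⟨ alternating-det n (alternating-map times-linear n (det-alternating n)) (tabulate M) ⟩
  Det M * detℤ n (map times (tabulate δ))         ≡⟨ cong (λ A → Det M * detℤ n A) (tabulate-∘ times δ) ⟨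
  Det M * Det (times ∘ δ)                           ≡⟨ cong (Det M *_) (Det-cong (λ i j → sum-δ i (λ k → N k j))) ⟩
  Det M * Det N                                   ∎
  where
  times : Row n → Row n
  times r j = sum (λ k → r k * N k j)
  lemma : ∀ c r s x → (c * r + s) * x ≡ c * (r * x) + s * x
  lemma = solve-∀
  times-linear : LinearMap times
  times-linear = record
    { ext = λ e j → sum-cong-≗ (λ k → cong (_* N k j) (e k))
    ; lin = λ c r s j → begin
        sum (λ k → (c * r k + s k) * N k j)             ≡⟨ sum-cong-≗ (λ k → lemma c (r k) (s k) (N k j)) ⟩
        sum (λ k → c * (r k * N k j) + s k * N k j)     ≡⟨ ∑-distrib-+ (λ k → c * (r k * N k j)) _ ⟩
        sum (λ k → c * (r k * N k j)) + times s j
          ≡⟨ cong (_+ times s j) (*-distribˡ-sum c (λ k → r k * N k j)) ⟨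
        c * times r j + times s j                       ∎
    }

Det-scalar : ∀ {n} (c : ℤ) → Det (λ (i : Fin (suc n)) j → c * δ i j) ≡ c * Det (λ (i : Fin n) j → c * δ i j)
Det-scalar {n} c = begin
  c * 1ℤ * D zero - alt (λ j → c * 0ℤ * D (suc j))
    ≡⟨ cong₂ _-_ (lemma c (D zero)) (alt-zero (λ j → lemma′ c (D (suc j)))) ⟩
  c * D zero - 0ℤ
    ≡⟨ ℤₚ.+-identityʳ _ ⟩
  c * D zero
    ≡⟨ cong (λ A → c * detℤ n A) (tabulate-∘ (delete zero) (λ i j → c * δ (suc i) j)) ⟨
  c * Det (λ (i : Fin n) j → c * δ i j) ∎
  where
  D : Fin (suc n) → ℤ
  D j = detℤ n (map (delete j) (tabulate (λ i j → c * δ (suc i) j)))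
  lemma : ∀ c d → c * 1ℤ * d ≡ c * d
  lemma = solve-∀
  lemma′ : ∀ c d → c * 0ℤ * d ≡ 0ℤ
  lemma′ = solve-∀

-- Integer polynomials and their values

eval : ℤ → Poly → ℤ
eval x []      = 0ℤ
eval x (a ∷ p) = a + x * eval x p

eval-+P : ∀ x p q → eval x (p +P q) ≡ eval x p + eval x q
eval-+P x []      q       = sym (ℤₚ.+-identityˡ _)
eval-+P x (a ∷ p) []      = sym (ℤₚ.+-identityʳ _)
eval-+P x (a ∷ p) (b ∷ q) =
  trans (cong (λ e → a + b + x * e) (eval-+P x p q)) (lemma a b x (eval x p) (eval x q))
  where
  lemma : ∀ a b x p q → a + b + x * (p + q) ≡ a + x * p + (b + x * q)
  lemma = solve-∀

eval-scaleP : ∀ x c p → eval x (scaleP c p) ≡ c * eval x p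
eval-scaleP x c []      = sym (ℤₚ.*-zeroʳ c)
eval-scaleP x c (a ∷ p) = trans (cong (λ e → c * a + x * e) (eval-scaleP x c p)) (lemma c a x (eval x p))
  where
  lemma : ∀ c a x p → c * a + x * (c * p) ≡ c * (a + x * p)
  lemma = solve-∀

eval-*P : ∀ x p q → eval x (p *P q) ≡ eval x p * eval x q
eval-*P x []      q = refl
eval-*P x (a ∷ p) q = begin
  eval x (scaleP a q +P (0ℤ ∷ (p *P q)))            ≡⟨ eval-+P x (scaleP a q) (0ℤ ∷ (p *P q)) ⟩
  eval x (scaleP a q) + (0ℤ + x * eval x (p *P q))
    ≡⟨ cong₂ (λ s t → s + (0ℤ + x * t)) (eval-scaleP x a q) (eval-*P x p q) ⟩
  a * eval x q + (0ℤ + x * (eval x p * eval x q))   ≡⟨ lemma a x (eval x p) (eval x q) ⟩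
  (a + x * eval x p) * eval x q                     ∎
  where
  lemma : ∀ a x p q → a * q + (0ℤ + x * (p * q)) ≡ (a + x * p) * q
  lemma = solve-∀

eval-negP : ∀ x p → eval x (negP p) ≡ - eval x p
eval-negP x []      = refl
eval-negP x (a ∷ p) = trans (cong (λ e → - a + x * e) (eval-negP x p)) (lemma a x (eval x p))
  where
  lemma : ∀ a x p → - a + x * - p ≡ - (a + x * p)
  lemma = solve-∀

coeff-+P : ∀ k p q → coeff k (p +P q) ≡ coeff k p + coeff k q
coeff-+P k       []      q       = sym (ℤₚ.+-identityˡ _)
coeff-+P k       (a ∷ p) []      = sym (ℤₚ.+-identityʳ _)
coeff-+P zero    (a ∷ p) (b ∷ q) = refl
coeff-+P (suc k) (a ∷ p) (b ∷ q) = coeff-+P k p q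

coeff-negP : ∀ k p → coeff k (negP p) ≡ - coeff k p
coeff-negP k       []      = refl
coeff-negP zero    (a ∷ p) = refl
coeff-negP (suc k) (a ∷ p) = coeff-negP k p

-- At a root n > ∣ a ∣ the constant coefficient a is divisible by n, hence zero.
coeff-zero : ∀ p N → (∀ n → N ℕ.≤ n → eval (+ n) p ≡ 0ℤ) → ∀ k → coeff k p ≡ 0ℤ
coeff-zero []      N e k = refl
coeff-zero (a ∷ p) N e k = coefficients k
  where
  neg : ∀ a b → a + b ≡ 0ℤ → a ≡ - b
  neg a b ab≡0 = trans (lemma a b) (trans (cong (_- b) ab≡0) (ℤₚ.+-identityˡ (- b)))
    where
    lemma : ∀ a b → a ≡ a + b - b
    lemma = solve-∀
  n = suc (ℤ.∣ a ∣ ⊔ N)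
  quotient : ℤ.∣ a ∣ ≡ ℤ.∣ eval (+ n) p ∣ ℕ.* n
  quotient = begin
    ℤ.∣ a ∣
      ≡⟨ cong ℤ.∣_∣ (neg a (+ n * eval (+ n) p) (e n (ℕₚ.m≤n⇒m≤1+n (ℕₚ.m≤n⊔m ℤ.∣ a ∣ N)))) ⟩
    ℤ.∣ - (+ n * eval (+ n) p) ∣       ≡⟨ ℤₚ.∣-i∣≡∣i∣ (+ n * eval (+ n) p) ⟩
    ℤ.∣ + n * eval (+ n) p ∣           ≡⟨ ℤₚ.∣i*j∣≡∣i∣*∣j∣ (+ n) (eval (+ n) p) ⟩
    n ℕ.* ℤ.∣ eval (+ n) p ∣           ≡⟨ ℕₚ.*-comm n _ ⟩
    ℤ.∣ eval (+ n) p ∣ ℕ.* n           ∎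
  ∣a∣≡0 : ∀ m → ℤ.∣ a ∣ ≡ m → m ≡ 0
  ∣a∣≡0 zero    _   = refl
  ∣a∣≡0 (suc m) a≡m = contradiction
    (∣⇒≤ (divides ℤ.∣ eval (+ n) p ∣ (trans (sym a≡m) quotient)))
    (ℕₚ.<⇒≱ (ℕ.s≤s (ℕₚ.≤-trans (ℕₚ.≤-reflexive (sym a≡m)) (ℕₚ.m≤m⊔n ℤ.∣ a ∣ N))))
  a≡0 : a ≡ 0ℤ
  a≡0 = ℤₚ.∣i∣≡0⇒i≡0 (∣a∣≡0 _ refl)
  -- The factor `+ m` cancels only for nonzero `m`, so the bound rises to `suc N` for the remaining
  -- polynomial.
  root : ∀ m → suc N ℕ.≤ m → eval (+ m) p ≡ 0ℤ
  root (suc m) N<m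
    with ℤₚ.i*j≡0⇒i≡0∨j≡0 (+ suc m)
           (trans (sym (ℤₚ.+-identityˡ _))
                  (trans (cong (_+ (+ suc m * eval (+ suc m) p)) (sym a≡0)) (e (suc m) (ℕₚ.<⇒≤ N<m))))
  ... | inj₂ p≡0 = p≡0
  coefficients : ∀ k → coeff k (a ∷ p) ≡ 0ℤ
  coefficients zero    = a≡0
  coefficients (suc k) = coeff-zero p (suc N) root k

eval-injective : ∀ p q → (∀ x → eval x p ≡ eval x q) → p ≈P q
eval-injective p q e k = ℤₚ.i-j≡0⇒i≡j (coeff k p) (coeff k q) (begin
  coeff k p - coeff k q          ≡⟨ cong (_+_ (coeff k p)) (coeff-negP k q) ⟨
  coeff k p + coeff k (negP q)   ≡⟨ coeff-+P k p (negP q) ⟨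
  coeff k (p +P negP q)          ≡⟨ coeff-zero (p +P negP q) 0 (λ n _ → difference (+ n)) k ⟩
  0ℤ                             ∎)
  where
  difference : ∀ x → eval x (p +P negP q) ≡ 0ℤ
  difference x = begin
    eval x (p +P negP q)          ≡⟨ eval-+P x p (negP q) ⟩
    eval x p + eval x (negP q)    ≡⟨ cong₂ _+_ (e x) (eval-negP x q) ⟩
    eval x q - eval x q           ≡⟨ ℤₚ.+-inverseʳ (eval x q) ⟩
    0ℤ                            ∎

-- The local function `expand` of `det` is not in scope, and unfolding `det`
-- shows it only with its counter tied to the dimension, which is too rigid for
-- an induction.  Anti-unifying two successive unfoldings abstracts the counter,
-- the column map and the sign into a single variable φ.  As all three
-- occurrences become φ, its type must adapt to each place: it is an implicit
-- function over the codes below.  The sign is stored negated (`flip`), since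
-- that is how it occurs in the unfoldings.

data Code : Set where
  counter   : Code
  flip      : Code
  columnMap : ℕ → ℕ → Code

El : Code → Set
El counter         = ℕ
El flip            = Bool
El (columnMap k n) = Fin k → Fin (suc n)

Arguments : Set
Arguments = {c : Code} → El c

-- An absurd hypothesis.  It only serves to type the endpoints of the equation
-- given to cong!, and erasure makes them reduce to the two unfoldings.
AllEqual : Set
AllEqual = (k n : ℕ) → k ≡ n

-- The state of the local recursion after one and after two terms have been split off: columns left,
-- negated sign, and column map (`suc`, then `suc` twice).
first second : ℕ → AllEqual → ∀ c → El c
first x eq counter           = suc x
first x eq flip              = true
first x eq (columnMap k n) y = subst Fin (cong suc (primEraseEquality (eq k n))) (suc y)
second x eq counter           = x
second x eq flip              = false
second x eq (columnMap k n) y = subst Fin (cong suc (primEraseEquality (eq (suc k) n))) (suc (suc y))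

-- Indexing by `cong F eq` exposes the function that `cong!` finds, so that unification can solve
-- for `F`.
data IsCong {X Y : Set} (F : X → Y) {x y : X} (eq : x ≡ y) : {l r : Y} → l ≡ r → Set where
  isCong : IsCong F eq (cong F eq)

-- The two equations peel the first two terms off `p` and thereby determine `q₁` and `q₂`, two
-- successive values of the local function. The last argument determines `F`, which is the result.
generalise : ∀ x (p p₁ p₂ : Poly) {q₁ q₂ : Poly} → p₁ +P q₁ ≡ p → p₂ +P q₂ ≡ q₁ → {F : Arguments → Poly} →
  ((h : AllEqual) (eq : _≡_ {A = Arguments} (λ {c} → first x h c) (λ {c} → second x h c)) →
    Σ (q₁ ≡ q₂) (IsCong F eq)) →
  Arguments → Poly
generalise x p p₁ p₂ _ _ {F} _ = F

PolyMatrix : ℕ → Set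
PolyMatrix n = Fin n → Fin n → Poly

minor : ∀ {n} → PolyMatrix (suc n) → Fin (suc n) → PolyMatrix n
minor M j r c = M (suc r) (punchIn j c)

cofactor : ∀ {n} → PolyMatrix (suc n) → Fin (suc n) → Poly
cofactor {n} M j = M zero j *P det n (minor M j)

expansion : ∀ x → PolyMatrix (suc (suc x)) → Arguments → Poly
expansion x M = generalise x (det (suc (suc x)) M) (cofactor M zero) (negP (cofactor M (suc zero)))
  refl refl (λ h eq → cong! eq , isCong)

-- An element of `Arguments` has a value at every code, hence a column map for every pair of sizes;
-- `expand` reads it at `k` and `suc x`.
ColumnMaps : Set
ColumnMaps = ∀ k n → Fin k → Fin (suc n)

arguments : ℕ → Bool → ColumnMaps → ∀ c → El c
arguments k b C counter           = k
arguments k b C flip              = b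
arguments k b C (columnMap k′ n′) = C k′ n′

expand : ∀ x → PolyMatrix (suc (suc x)) → ℕ → Bool → ColumnMaps → Poly
expand x M k b C = expansion x M (λ {c} → arguments k b C c)

-- Counter, sign and column map now vary freely, so induction on the counter goes through; the sign
-- in front is the negated sign `b` undone.
eval-expand : ∀ z x M k b C →
  eval z (expand x M k b C) ≡ (if b then -1ℤ else 1ℤ) * alt (λ j → eval z (cofactor M (C k (suc x) j)))
eval-expand z x M zero    b C = sym (ℤₚ.*-zeroʳ (if b then -1ℤ else 1ℤ))
eval-expand z x M (suc k) true C = begin
  eval z (negP t +P expand x M k false C′)           ≡⟨ eval-+P z (negP t) (expand x M k false C′) ⟩
  eval z (negP t) + eval z (expand x M k false C′)
    ≡⟨ cong₂ _+_ (eval-negP z t) (eval-expand z x M k false C′) ⟩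
  - eval z t + 1ℤ * a                                ≡⟨ lemma (eval z t) a ⟩
  -1ℤ * (eval z t - a)                               ∎
  where
  C′ : ColumnMaps
  C′ k n y = C (suc k) n (suc y)
  t = cofactor M (C (suc k) (suc x) zero)
  a = alt (λ j → eval z (cofactor M (C′ k (suc x) j)))
  lemma : ∀ t a → - t + 1ℤ * a ≡ -1ℤ * (t - a)
  lemma = solve-∀
eval-expand z x M (suc k) false C = begin
  eval z (t +P expand x M k true C′)           ≡⟨ eval-+P z t (expand x M k true C′) ⟩
  eval z t + eval z (expand x M k true C′)     ≡⟨ cong (_+_ (eval z t)) (eval-expand z x M k true C′) ⟩
  eval z t + -1ℤ * a                           ≡⟨ lemma (eval z t) a ⟩
  1ℤ * (eval z t - a)                          ∎
  where
  C′ : ColumnMaps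
  C′ k n y = C (suc k) n (suc y)
  t = cofactor M (C (suc k) (suc x) zero)
  a = alt (λ j → eval z (cofactor M (C′ k (suc x) j)))
  lemma : ∀ t a → t + -1ℤ * a ≡ 1ℤ * (t - a)
  lemma = solve-∀

-- After its first term `det` uses the column map `suc`, which is well typed for `k ≡ n`. Deciding
-- this equation extends it to all sizes, with `zero` as filler.
shiftIf : ∀ {k n} → Dec (k ≡ n) → Fin k → Fin (suc n)
shiftIf (yes k≡n) y = subst Fin (cong suc k≡n) (suc y)
shiftIf (no _)    y = zero

-- With the decision procedure a variable, `suc x ≟ suc x` is a neutral term that the rewrite
-- replaces by `yes refl`; `shiftIf` then computes to `suc`.
det-expand : ∀ x M (_≟_ : ∀ k n → Dec (k ≡ n)) → (suc x ≟ suc x) ≡ yes refl →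
             det (suc (suc x)) M ≡ cofactor M zero +P expand x M (suc x) true (λ k n → shiftIf (k ≟ n))
det-expand x M _≟_ e rewrite e = refl

eval-det-expand : ∀ z n (M : PolyMatrix (suc n)) → eval z (det (suc n) M) ≡ alt (λ j → eval z (cofactor M j))
eval-det-expand z zero    M = trans (eval-+P z (cofactor M zero) []) refl
eval-det-expand z (suc x) M = begin
  eval z (det (suc (suc x)) M)
    ≡⟨ cong (eval z) (det-expand x M ℕₚ._≟_ (ℕₚ.≟-diag refl)) ⟩
  eval z (cofactor M zero +P expand x M (suc x) true shift)
    ≡⟨ eval-+P z (cofactor M zero) (expand x M (suc x) true shift) ⟩
  eval z (cofactor M zero) + eval z (expand x M (suc x) true shift)
    ≡⟨ cong (_+_ (eval z (cofactor M zero))) (eval-expand z x M (suc x) true shift) ⟩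
  eval z (cofactor M zero) + -1ℤ * alt (λ j → eval z (cofactor M (shift (suc x) (suc x) j)))
    ≡⟨ cong (λ a → eval z (cofactor M zero) + -1ℤ * a)
         (alt-cong (λ j → cong (λ d → eval z (cofactor M (shiftIf d j))) (ℕₚ.≟-diag refl))) ⟩
  eval z (cofactor M zero) + -1ℤ * alt (λ j → eval z (cofactor M (suc j)))
    ≡⟨ cong (_+_ (eval z (cofactor M zero))) (ℤₚ.-1*i≡-i _) ⟩
  alt (λ j → eval z (cofactor M j)) ∎
  where
  shift : ColumnMaps
  shift k n = shiftIf (k ℕₚ.≟ n)

eval-det : ∀ z n (M : PolyMatrix n) → eval z (det n M) ≡ Det (λ i j → eval z (M i j))
eval-det z zero    M = cong (_+_ 1ℤ) (ℤₚ.*-zeroʳ z)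
eval-det z (suc n) M = trans (eval-det-expand z n M) (alt-cong λ j → begin
  eval z (M zero j *P det n (minor M j))           ≡⟨ eval-*P z (M zero j) (det n (minor M j)) ⟩
  eval z (M zero j) * eval z (det n (minor M j))
    ≡⟨ cong (eval z (M zero j) *_) (eval-det z n (minor M j)) ⟩
  eval z (M zero j) * detℤ n (tabulate (delete j ∘ λ i c → eval z (M (suc i) c)))
    ≡⟨ cong (λ A → eval z (M zero j) * detℤ n A) (tabulate-∘ (delete j) (λ i c → eval z (M (suc i) c))) ⟩
  eval z (M zero j) * detℤ n (map (delete j) (tabulate (λ i c → eval z (M (suc i) c)))) ∎)

-- Distances in a coalescence

_▷_ : ∀ {n} {A : Adjacency n} {i j k p q} → Walk A i j p → Walk A j k q → Walk A i k (p ℕ.+ q)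
stay     ▷ w′ = w′
step e w ▷ w′ = step e (w ▷ w′)

walk-map : ∀ {n n′} {A : Adjacency n} {A′ : Adjacency n′} (f : Fin n → Fin n′) →
           (∀ {i j} → A i j ≡ true → A′ (f i) (f j) ≡ true) →
           ∀ {i j k} → Walk A i j k → Walk A′ (f i) (f j) k
walk-map f hom stay       = stay
walk-map f hom (step e w) = step (hom e) (walk-map f hom w)

-- A local certificate for distances: `lipschitz` makes `d` a lower bound for walk lengths, and
-- `descent` builds a walk that attains it. For a concrete graph both are finite checks.
module Distances {n : ℕ} (A : Adjacency n) (d : Fin n → Fin n → ℕ)
  (diagonal  : ∀ i → d i i ≡ 0)
  (lipschitz : ∀ i l → A i l ≡ true → ∀ j → d i j ≤ suc (d l j))
  (descent   : ∀ i j → i ≡ j ⊎ ∃ λ l → A i l ≡ true × d i j ≡ suc (d l j)) where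

  shortest : ∀ {k} i j → d i j ≡ k → Walk A i j k
  shortest i j dij≡k with descent i j
  ... | inj₁ refl            = subst (Walk A i i) (trans (sym (diagonal i)) dij≡k) stay
  shortest {zero} i j dij≡0 | inj₂ (l , e , eq) = contradiction (trans (sym dij≡0) eq) (λ ())
  shortest {suc k} i j dij≡k | inj₂ (l , e , eq) = step e (shortest l j (ℕₚ.suc-injective (trans (sym eq) dij≡k)))

  bound : ∀ {i j k} → Walk A i j k → d i j ≤ k
  bound {i} stay              = ℕₚ.≤-reflexive (diagonal i)
  bound {i} {j} (step {l = l} e w) = ℕₚ.≤-trans (lipschitz i l e j) (s≤s (bound w))

  isDistanceMatrix : IsDistanceMatrix A d
  isDistanceMatrix i j = shortest i j refl , λ k → bound

-- The distance matrices of `G` and `H`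

table : Vec (Vec ℕ 10) 10 → Fin 10 → Fin 10 → ℕ
table t i j = lookup (lookup t i) j

dG dH : Fin 10 → Fin 10 → ℕ
dG = table
  ( (0 ∷ 1 ∷ 1 ∷ 1 ∷ 2 ∷ 1 ∷ 2 ∷ 2 ∷ 2 ∷ 2 ∷ [])
  ∷ (1 ∷ 0 ∷ 2 ∷ 2 ∷ 3 ∷ 1 ∷ 3 ∷ 1 ∷ 2 ∷ 3 ∷ [])
  ∷ (1 ∷ 2 ∷ 0 ∷ 1 ∷ 1 ∷ 2 ∷ 1 ∷ 3 ∷ 3 ∷ 1 ∷ [])
  ∷ (1 ∷ 2 ∷ 1 ∷ 0 ∷ 1 ∷ 1 ∷ 1 ∷ 2 ∷ 2 ∷ 2 ∷ [])
  ∷ (2 ∷ 3 ∷ 1 ∷ 1 ∷ 0 ∷ 2 ∷ 2 ∷ 3 ∷ 3 ∷ 1 ∷ [])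
  ∷ (1 ∷ 1 ∷ 2 ∷ 1 ∷ 2 ∷ 0 ∷ 2 ∷ 1 ∷ 1 ∷ 3 ∷ [])
  ∷ (2 ∷ 3 ∷ 1 ∷ 1 ∷ 2 ∷ 2 ∷ 0 ∷ 3 ∷ 3 ∷ 1 ∷ [])
  ∷ (2 ∷ 1 ∷ 3 ∷ 2 ∷ 3 ∷ 1 ∷ 3 ∷ 0 ∷ 2 ∷ 4 ∷ [])
  ∷ (2 ∷ 2 ∷ 3 ∷ 2 ∷ 3 ∷ 1 ∷ 3 ∷ 2 ∷ 0 ∷ 4 ∷ [])
  ∷ (2 ∷ 3 ∷ 1 ∷ 2 ∷ 1 ∷ 3 ∷ 1 ∷ 4 ∷ 4 ∷ 0 ∷ [])
  ∷ [])
dH = table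
  ( (0 ∷ 1 ∷ 1 ∷ 1 ∷ 2 ∷ 1 ∷ 2 ∷ 2 ∷ 2 ∷ 2 ∷ [])
  ∷ (1 ∷ 0 ∷ 2 ∷ 2 ∷ 3 ∷ 1 ∷ 3 ∷ 1 ∷ 2 ∷ 3 ∷ [])
  ∷ (1 ∷ 2 ∷ 0 ∷ 1 ∷ 1 ∷ 1 ∷ 1 ∷ 3 ∷ 2 ∷ 1 ∷ [])
  ∷ (1 ∷ 2 ∷ 1 ∷ 0 ∷ 2 ∷ 2 ∷ 2 ∷ 2 ∷ 1 ∷ 2 ∷ [])
  ∷ (2 ∷ 3 ∷ 1 ∷ 2 ∷ 0 ∷ 2 ∷ 2 ∷ 4 ∷ 3 ∷ 1 ∷ [])
  ∷ (1 ∷ 1 ∷ 1 ∷ 2 ∷ 2 ∷ 0 ∷ 2 ∷ 2 ∷ 1 ∷ 2 ∷ [])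
  ∷ (2 ∷ 3 ∷ 1 ∷ 2 ∷ 2 ∷ 2 ∷ 0 ∷ 4 ∷ 3 ∷ 1 ∷ [])
  ∷ (2 ∷ 1 ∷ 3 ∷ 2 ∷ 4 ∷ 2 ∷ 4 ∷ 0 ∷ 1 ∷ 4 ∷ [])
  ∷ (2 ∷ 2 ∷ 2 ∷ 1 ∷ 3 ∷ 1 ∷ 3 ∷ 1 ∷ 0 ∷ 3 ∷ [])
  ∷ (2 ∷ 3 ∷ 1 ∷ 2 ∷ 1 ∷ 2 ∷ 1 ∷ 4 ∷ 3 ∷ 0 ∷ [])
  ∷ [])

module Check (A : Adjacency 10) (d : Fin 10 → Fin 10 → ℕ) where

  diagonal? : Dec (∀ i → d i i ≡ 0)
  diagonal? = all? λ i → d i i ℕ.≟ 0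

  lipschitz? : Dec (∀ i l → A i l ≡ true → ∀ j → d i j ≤ suc (d l j))
  lipschitz? = all? λ i → all? λ l → (A i l ≟ᵇ true) →-dec all? λ j → d i j ℕ.≤? suc (d l j)

  descent? : Dec (∀ i j → i ≡ j ⊎ ∃ λ l → A i l ≡ true × d i j ≡ suc (d l j))
  descent? = all? λ i → all? λ j → (i ≟ j) ⊎-dec any? λ l → (A i l ≟ᵇ true) ×-dec (d i j ℕ.≟ suc (d l j))

  distances : {_ : True diagonal?} {_ : True lipschitz?} {_ : True descent?} → IsDistanceMatrix A d
  distances {p} {q} {r} = Distances.isDistanceMatrix A d (toWitness p) (toWitness q) (toWitness r)

dG-distance : IsDistanceMatrix G dG
dG-distance = Check.distances G dG

dH-distance : IsDistanceMatrix H dH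
dH-distance = Check.distances H dH

-- Projections and embeddings of a coalescence

module Coalescence {n m : ℕ} (u : Fin n) (v : Fin (suc m)) where

  V = Fin (n ℕ.+ m)

  -- `ρ` folds the second graph onto `u` and `φ` folds the first onto `v`: they are retractions of
  -- the embeddings `ι` and `ψ`.
  ρ : V → Fin n
  ρ z = [ id , const u ]′ (splitAt n z)

  φ : V → Fin (suc m)
  φ z = [ const v , punchIn v ]′ (splitAt n z)

  ι : Fin n → V
  ι a = a ↑ˡ m

  ψ : Fin (suc m) → V
  ψ x with v ≟ x
  ... | yes _   = ι u
  ... | no v≢x = n ↑ʳ punchOut v≢x

  ρ-ι : ∀ a → ρ (ι a) ≡ a
  ρ-ι a = cong [ id , const u ]′ (splitAt-↑ˡ n a m)

  φ-ι : ∀ a → φ (ι a) ≡ v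
  φ-ι a = cong [ const v , punchIn v ]′ (splitAt-↑ˡ n a m)

  ρ-κ : ∀ b → ρ (n ↑ʳ b) ≡ u
  ρ-κ b = cong [ id , const u ]′ (splitAt-↑ʳ n m b)

  φ-κ : ∀ b → φ (n ↑ʳ b) ≡ punchIn v b
  φ-κ b = cong [ const v , punchIn v ]′ (splitAt-↑ʳ n m b)

  φ-ψ : ∀ x → φ (ψ x) ≡ x
  φ-ψ x with v ≟ x
  ... | yes refl = φ-ι u
  ... | no v≢x = trans (φ-κ (punchOut v≢x)) (punchIn-punchOut v≢x)

  ψ-v : ψ v ≡ ι u
  ψ-v with v ≟ v
  ... | yes _   = refl
  ... | no v≢v = contradiction refl v≢v

  ψ-punchIn : ∀ b → ψ (punchIn v b) ≡ n ↑ʳ b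
  ψ-punchIn b with v ≟ punchIn v b
  ... | yes v≡ = contradiction (sym v≡) (punchInᵢ≢i v b)
  ... | no v≢  = cong (n ↑ʳ_) (trans (punchOut-cong v refl) (punchOut-punchIn v))

  side : ∀ z → (z ≡ ι (ρ z) × φ z ≡ v) ⊎ (z ≡ ψ (φ z) × ρ z ≡ u)
  side z with splitAt n z | join-splitAt n m z
  ... | inj₁ a | z≡ = inj₁ (sym z≡ , refl)
  ... | inj₂ b | z≡ = inj₂ (trans (sym z≡) (sym (ψ-punchIn b)) , refl)

module Glue {m : ℕ} (B : Adjacency 10) (u : Fin 10) (K : Adjacency (suc m)) (v : Fin (suc m)) where

  open Coalescence u v

  ι-hom : ∀ {a b} → B a b ≡ true → glue B u K v (ι a) (ι b) ≡ true
  ι-hom {a} {b} e rewrite splitAt-↑ˡ 10 a m | splitAt-↑ˡ 10 b m | e = refl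

  ψ-hom : ∀ {x y} → K x y ≡ true → glue B u K v (ψ x) (ψ y) ≡ true
  ψ-hom {x} {y} e with v ≟ x | v ≟ y
  ... | yes refl | yes refl rewrite splitAt-↑ˡ 10 u m | dec-true (u ≟ u) refl | e = ∨-zeroʳ (B u u)
  ... | yes refl | no v≢y
    rewrite splitAt-↑ˡ 10 u m | splitAt-↑ʳ 10 m (punchOut v≢y) | dec-true (u ≟ u) refl | punchIn-punchOut v≢y = e
  ... | no v≢x | yes refl
    rewrite splitAt-↑ˡ 10 u m | splitAt-↑ʳ 10 m (punchOut v≢x) | dec-true (u ≟ u) refl | punchIn-punchOut v≢x = e
  ... | no v≢x | no v≢y
    rewrite splitAt-↑ʳ 10 m (punchOut v≢x) | splitAt-↑ʳ 10 m (punchOut v≢y)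
          | punchIn-punchOut v≢x | punchIn-punchOut v≢y = e

  -- A step moves in one factor and rests in the other, so the length of a walk is the sum of the
  -- lengths of its two projections.
  edge : ∀ x y → glue B u K v x y ≡ true →
         (B (ρ x) (ρ y) ≡ true × φ x ≡ φ y) ⊎ (ρ x ≡ ρ y × K (φ x) (φ y) ≡ true)
  edge x y e with splitAt 10 x | splitAt 10 y
  edge x y e | inj₁ a | inj₁ b with B a b in Bab
  ... | true = inj₁ (refl , refl)
  ... | false with a ≟ u | b ≟ u
  ...   | yes refl | yes refl = inj₂ (refl , e)
  ...   | yes refl | no _ = contradiction e λ ()
  ...   | no _ | _ = contradiction e λ ()
  edge x y e | inj₁ a | inj₂ c with a ≟ u
  ... | yes refl = inj₂ (refl , e)
  edge x y e | inj₂ c | inj₁ a with a ≟ u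
  ... | yes refl = inj₂ (refl , e)
  edge x y e | inj₂ c | inj₂ c′ = inj₂ (refl , e)

  unglue : ∀ {x y k} → Walk (glue B u K v) x y k →
           ∃ λ p → ∃ λ q → Walk B (ρ x) (ρ y) p × Walk K (φ x) (φ y) q × p ℕ.+ q ≡ k
  unglue stay = 0 , 0 , stay , stay , refl
  unglue {x} {y} (step {l = l} e w) with unglue w | edge x l e
  ... | p , q , w₁ , w₂ , eq | inj₁ (b , s) =
    suc p , q , step b w₁ , subst (λ z → Walk K z (φ y) q) (sym s) w₂ , cong suc eq
  ... | p , q , w₁ , w₂ , eq | inj₂ (s , k) =
    p , suc q , subst (λ z → Walk B z (ρ y) p) (sym s) w₁ , step k w₂ , trans (ℕₚ.+-suc p q) (cong suc eq)

  -- Only an inequality: for two vertices on the same side, the walk in the other factor is closed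
  -- at the merged vertex and is dropped. Otherwise the two walks are joined at that vertex.
  reglue : ∀ {x y p q} → Walk B (ρ x) (ρ y) p → Walk K (φ x) (φ y) q →
           ∃ λ k → Walk (glue B u K v) x y k × k ≤ p ℕ.+ q
  reglue {x} {y} {p} {q} w₁ w₂ with side x | side y
  ... | inj₁ (x≡ , _) | inj₁ (y≡ , _) =
    p , subst₂ (λ x y → Walk _ x y p) (sym x≡) (sym y≡) (walk-map ι ι-hom w₁) , ℕₚ.m≤m+n p q
  ... | inj₂ (x≡ , _) | inj₂ (y≡ , _) =
    q , subst₂ (λ x y → Walk _ x y q) (sym x≡) (sym y≡) (walk-map ψ ψ-hom w₂) , ℕₚ.m≤n+m q p
  ... | inj₁ (x≡ , φx≡v) | inj₂ (y≡ , ρy≡u) =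
    p ℕ.+ q ,
    subst₂ (λ x y → Walk _ x y p) (sym x≡) (cong ι ρy≡u) (walk-map ι ι-hom w₁) ▷
    subst₂ (λ x y → Walk _ x y q) (trans (cong ψ φx≡v) ψ-v) (sym y≡) (walk-map ψ ψ-hom w₂) ,
    ℕₚ.≤-refl
  ... | inj₂ (x≡ , ρx≡u) | inj₁ (y≡ , φy≡v) =
    q ℕ.+ p ,
    subst₂ (λ x y → Walk _ x y q) (sym x≡) (trans (cong ψ φy≡v) ψ-v) (walk-map ψ ψ-hom w₂) ▷
    subst₂ (λ x y → Walk _ x y p) (cong ι ρx≡u) (sym y≡) (walk-map ι ι-hom w₁) ,
    ℕₚ.≤-reflexive (ℕₚ.+-comm q p)

  module _ {D : V → V → ℕ} (isD : IsDistanceMatrix (glue B u K v) D) where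

    -- This obtains distances in `K` without a search. A shortest walk between `ψ x` and `ψ y`
    -- projects to a walk in `K` that is no longer, and `ψ` maps every walk of `K` back with its
    -- length.
    factor-distance : IsDistanceMatrix K (λ x y → D (ψ x) (ψ y))
    factor-distance x y = walk (unglue (proj₁ (isD (ψ x) (ψ y)))) , shortest
      where
      shortest : ∀ k → Walk K x y k → D (ψ x) (ψ y) ≤ k
      shortest k w = proj₂ (isD (ψ x) (ψ y)) k (walk-map ψ ψ-hom w)
      walk : (∃ λ p → ∃ λ q → Walk B (ρ (ψ x)) (ρ (ψ y)) p × Walk K (φ (ψ x)) (φ (ψ y)) q × p ℕ.+ q ≡ D (ψ x) (ψ y)) →
             Walk K x y (D (ψ x) (ψ y))
      walk (p , q , _ , w , p+q≡D) =
        subst (Walk K x y)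
          (ℕₚ.≤-antisym (ℕₚ.≤-trans (ℕₚ.m≤n+m q p) (ℕₚ.≤-reflexive p+q≡D)) (shortest q w′)) w′
        where
        w′ : Walk K x y q
        w′ = subst₂ (λ x y → Walk K x y q) (φ-ψ x) (φ-ψ y) w

    glue-distance : ∀ {dB dK} → IsDistanceMatrix B dB → IsDistanceMatrix K dK →
                    ∀ x y → D x y ≡ dB (ρ x) (ρ y) ℕ.+ dK (φ x) (φ y)
    glue-distance isdB isdK x y = ℕₚ.≤-antisym upper lower
      where
      upper : D x y ≤ _
      upper with k , w , k≤ ← reglue {x} {y} (proj₁ (isdB (ρ x) (ρ y))) (proj₁ (isdK (φ x) (φ y))) =
        ℕₚ.≤-trans (proj₂ (isD x y) k w) k≤
      lower : _ ≤ D x y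
      lower with p , q , w₁ , w₂ , eq ← unglue (proj₁ (isD x y)) =
        ℕₚ.≤-trans (ℕₚ.+-mono-≤ (proj₂ (isdB (ρ x) (ρ y)) p w₁) (proj₂ (isdK (φ x) (φ y)) q w₂)) (ℕₚ.≤-reflexive eq)

-- Similarity of the coalesced distance matrices

sum-δʳ : ∀ {n} (j : Fin n) (f : Fin n → ℤ) → sum (λ k → f k * δ k j) ≡ f j
sum-δʳ j f = trans (sum-cong-≗ (λ k → trans (ℤₚ.*-comm (f k) (δ k j)) (cong (_* f k) (δ-sym k j)))) (sum-δ j f)
  where
  δ-sym : ∀ {n} (i j : Fin n) → δ i j ≡ δ j i
  δ-sym zero    zero    = refl
  δ-sym zero    (suc j) = refl
  δ-sym (suc i) zero    = refl
  δ-sym (suc i) (suc j) = δ-sym i j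

Det-scalar≢0 : ∀ n c → c ≢ 0ℤ → Det (λ (i : Fin n) j → c * δ i j) ≢ 0ℤ
Det-scalar≢0 zero    c c≢0 ()
Det-scalar≢0 (suc n) c c≢0 e with ℤₚ.i*j≡0⇒i≡0∨j≡0 c (trans (sym (Det-scalar {n} c)) e)
... | inj₁ c≡0 = c≢0 c≡0
... | inj₂ d≡0 = Det-scalar≢0 n c c≢0 d≡0

-- `T′` certifies that `Det T` is nonzero, since `Det T` divides the determinant of a nonzero scalar
-- matrix.
Det-intertwined : ∀ {n} (T T′ M N : Square n) c → c ≢ 0ℤ →
                 (∀ i → (T′ ⊗ T) i ≗ λ j → c * δ i j) → (∀ i → (T ⊗ M) i ≗ (N ⊗ T) i) → Det M ≡ Det N
Det-intertwined {n} T T′ M N c c≢0 T′T TM = ℤₚ.*-cancelˡ-≡ (Det T) (Det M) (Det N) {{ℤ.≢-nonZero DetT≢0}} (begin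
  Det T * Det M     ≡⟨ Det-⊗ T M ⟨
  Det (T ⊗ M)         ≡⟨ Det-cong TM ⟩
  Det (N ⊗ T)         ≡⟨ Det-⊗ N T ⟩
  Det N * Det T     ≡⟨ ℤₚ.*-comm (Det N) (Det T) ⟩
  Det T * Det N     ∎)
  where
  DetT≢0 : Det T ≢ 0ℤ
  DetT≢0 e = Det-scalar≢0 n c c≢0 (begin
    Det {n} (λ i j → c * δ i j)   ≡⟨ Det-cong T′T ⟨
    Det (T′ ⊗ T)                ≡⟨ Det-⊗ T′ T ⟩
    Det T′ * Det T            ≡⟨ cong (Det T′ *_) e ⟩
    Det T′ * 0ℤ               ≡⟨ ℤₚ.*-zeroʳ (Det T′) ⟩
    0ℤ                        ∎)

characteristic : ∀ {n} → ℤ → Square n → Square n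
characteristic z D i j = z * δ i j - D i j

intertwine-characteristic : ∀ {n} z (T D E : Square n) → (∀ i → (T ⊗ D) i ≗ (E ⊗ T) i) →
  ∀ i → (T ⊗ characteristic z D) i ≗ (characteristic z E ⊗ T) i
intertwine-characteristic z T D E TD i j = begin
  sum (λ k → T i k * (z * δ k j - D k j))
    ≡⟨ sum-cong-≗ (λ k → left (T i k) z (δ k j) (D k j)) ⟩
  sum (λ k → z * (T i k * δ k j) + -1ℤ * (T i k * D k j))
    ≡⟨ sum-combination z (λ k → T i k * δ k j) -1ℤ (λ k → T i k * D k j) ⟩
  z * sum (λ k → T i k * δ k j) + -1ℤ * (T ⊗ D) i j
    ≡⟨ cong₂ (λ a b → z * a + -1ℤ * b) (trans (sum-δʳ j (T i)) (sym (sum-δ i (λ k → T k j)))) (TD i j) ⟩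
  z * sum (λ k → δ i k * T k j) + -1ℤ * (E ⊗ T) i j
    ≡⟨ sum-combination z (λ k → δ i k * T k j) -1ℤ (λ k → E i k * T k j) ⟨
  sum (λ k → z * (δ i k * T k j) + -1ℤ * (E i k * T k j))
    ≡⟨ sum-cong-≗ (λ k → right (T k j) z (δ i k) (E i k)) ⟨
  sum (λ k → (z * δ i k - E i k) * T k j) ∎
  where
  left : ∀ t z d e → t * (z * d - e) ≡ z * (t * d) + -1ℤ * (t * e)
  left = solve-∀
  right : ∀ t z d e → (z * d - e) * t ≡ z * (d * t) + -1ℤ * (e * t)
  right = solve-∀
  sum-combination : ∀ {n} a (f : Fin n → ℤ) b g → sum (λ k → a * f k + b * g k) ≡ a * sum f + b * sum g
  sum-combination a f b g = trans (∑-distrib-+ (λ k → a * f k) (λ k → b * g k))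
    (cong₂ _+_ (sym (*-distribˡ-sum a f)) (sym (*-distribˡ-sum b g)))

eval-charPoly : ∀ z {n} (D : Fin n → Fin n → ℕ) →
                eval z (charPoly D) ≡ Det (characteristic z (λ i j → + D i j))
eval-charPoly z {n} D = trans
  (eval-det z n (λ i j → if does (i ≟ j) then (- (+ D i j)) ∷ 1ℤ ∷ [] else (- (+ D i j)) ∷ []))
  (Det-cong (λ i j → trans (entry (does (i ≟ j)) (+ D i j)) (cong (λ e → z * e - + D i j) (sym (δ-≟ i j)))))
  where
  δ-≟ : ∀ {n} (i j : Fin n) → δ i j ≡ (if does (i ≟ j) then 1ℤ else 0ℤ)
  δ-≟ zero    zero    = refl
  δ-≟ zero    (suc j) = refl
  δ-≟ (suc i) zero    = refl
  δ-≟ (suc i) (suc j) = δ-≟ i j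
  on : ∀ z d → - d + z * (1ℤ + z * 0ℤ) ≡ z * 1ℤ - d
  on = solve-∀
  off : ∀ z d → - d + z * 0ℤ ≡ z * 0ℤ - d
  off = solve-∀
  entry : ∀ b d → eval z (if b then - d ∷ 1ℤ ∷ [] else - d ∷ []) ≡ z * (if b then 1ℤ else 0ℤ) - d
  entry true  d = on z d
  entry false d = off z d

-- Block matrices

↑-elim : ∀ n {m} (P : Fin (n ℕ.+ m) → Set) → (∀ i → P (i ↑ˡ m)) → (∀ j → P (n ↑ʳ j)) → ∀ x → P x
↑-elim zero    P l r x       = r x
↑-elim (suc n) P l r zero    = l zero
↑-elim (suc n) P l r (suc x) = ↑-elim n (P ∘ suc) (l ∘ suc) r x

sum-↑ : ∀ n {m} (f : Fin (n ℕ.+ m) → ℤ) → sum f ≡ sum (λ i → f (i ↑ˡ m)) + sum (λ j → f (n ↑ʳ j))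
sum-↑ zero    f = sym (ℤₚ.+-identityˡ (sum f))
sum-↑ (suc n) f = trans (cong (_+_ (f zero)) (sum-↑ n (f ∘ suc))) (sym (ℤₚ.+-assoc (f zero) _ _))

δ-ll : ∀ {n} m (i j : Fin n) → δ (i ↑ˡ m) (j ↑ˡ m) ≡ δ i j
δ-ll m zero    zero    = refl
δ-ll m zero    (suc j) = refl
δ-ll m (suc i) zero    = refl
δ-ll m (suc i) (suc j) = δ-ll m i j

δ-lr : ∀ {n m} (i : Fin n) (b : Fin m) → δ (i ↑ˡ m) (n ↑ʳ b) ≡ 0ℤ
δ-lr zero    b = refl
δ-lr (suc i) b = δ-lr i b

δ-rl : ∀ {n m} (a : Fin m) (j : Fin n) → δ (n ↑ʳ a) (j ↑ˡ m) ≡ 0ℤ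
δ-rl a zero    = refl
δ-rl a (suc j) = δ-rl a j

δ-rr : ∀ n {m} (a b : Fin m) → δ (n ↑ʳ a) (n ↑ʳ b) ≡ δ a b
δ-rr zero    a b = refl
δ-rr (suc n) a b = δ-rr n a b

module Block {n m : ℕ} (P : Square n) (c : ℤ) where

  block : Square (n ℕ.+ m)
  block x y with splitAt n x | splitAt n y
  ... | inj₁ i | inj₁ j = P i j
  ... | inj₁ _ | inj₂ _ = 0ℤ
  ... | inj₂ _ | inj₁ _ = 0ℤ
  ... | inj₂ a | inj₂ b = c * δ a b

  block-ll : ∀ i j → block (i ↑ˡ m) (j ↑ˡ m) ≡ P i j
  block-ll i j rewrite splitAt-↑ˡ n i m | splitAt-↑ˡ n j m = refl

  block-lr : ∀ i b → block (i ↑ˡ m) (n ↑ʳ b) ≡ 0ℤ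
  block-lr i b rewrite splitAt-↑ˡ n i m | splitAt-↑ʳ n m b = refl

  block-rl : ∀ a j → block (n ↑ʳ a) (j ↑ˡ m) ≡ 0ℤ
  block-rl a j rewrite splitAt-↑ʳ n m a | splitAt-↑ˡ n j m = refl

  block-rr : ∀ a b → block (n ↑ʳ a) (n ↑ʳ b) ≡ c * δ a b
  block-rr a b rewrite splitAt-↑ʳ n m a | splitAt-↑ʳ n m b = refl

  private
    sum-zero : ∀ {k} (f g : Fin k → ℤ) → (∀ i → f i ≡ 0ℤ) → sum (λ i → f i * g i) ≡ 0ℤ
    sum-zero f g f≡0 = trans (sum-cong-≗ (λ i → cong (_* g i) (f≡0 i))) (sym (*-distribˡ-sum 0ℤ g))

    sum-scaled : ∀ {k} (f : Fin k → ℤ) (w : Fin k → ℤ) → sum (λ i → c * w i * f i) ≡ c * sum (λ i → w i * f i)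
    sum-scaled f w = trans (sum-cong-≗ (λ i → ℤₚ.*-assoc c (w i) (f i))) (sym (*-distribˡ-sum c (λ i → w i * f i)))

  block-⊗-l : ∀ N i y → (block ⊗ N) (i ↑ˡ m) y ≡ sum (λ k → P i k * N (k ↑ˡ m) y)
  block-⊗-l N i y = begin
    (block ⊗ N) (i ↑ˡ m) y
      ≡⟨ sum-↑ n (λ z → block (i ↑ˡ m) z * N z y) ⟩
    sum (λ k → block (i ↑ˡ m) (k ↑ˡ m) * N (k ↑ˡ m) y) + sum (λ b → block (i ↑ˡ m) (n ↑ʳ b) * N (n ↑ʳ b) y)
      ≡⟨ cong₂ _+_ (sum-cong-≗ (λ k → cong (_* N (k ↑ˡ m) y) (block-ll i k)))
                   (sum-zero (λ b → block (i ↑ˡ m) (n ↑ʳ b)) (λ b → N (n ↑ʳ b) y) (block-lr i)) ⟩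
    sum (λ k → P i k * N (k ↑ˡ m) y) + 0ℤ
      ≡⟨ ℤₚ.+-identityʳ _ ⟩
    sum (λ k → P i k * N (k ↑ˡ m) y) ∎

  block-⊗-r : ∀ N a y → (block ⊗ N) (n ↑ʳ a) y ≡ c * N (n ↑ʳ a) y
  block-⊗-r N a y = begin
    (block ⊗ N) (n ↑ʳ a) y
      ≡⟨ sum-↑ n (λ z → block (n ↑ʳ a) z * N z y) ⟩
    sum (λ k → block (n ↑ʳ a) (k ↑ˡ m) * N (k ↑ˡ m) y) + sum (λ b → block (n ↑ʳ a) (n ↑ʳ b) * N (n ↑ʳ b) y)
      ≡⟨ cong₂ _+_ (sum-zero (λ k → block (n ↑ʳ a) (k ↑ˡ m)) (λ k → N (k ↑ˡ m) y) (block-rl a))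
                   (sum-cong-≗ (λ b → cong (_* N (n ↑ʳ b) y) (block-rr a b))) ⟩
    0ℤ + sum (λ b → c * δ a b * N (n ↑ʳ b) y)
      ≡⟨ ℤₚ.+-identityˡ _ ⟩
    sum (λ b → c * δ a b * N (n ↑ʳ b) y)
      ≡⟨ sum-scaled (λ b → N (n ↑ʳ b) y) (δ a) ⟩
    c * sum (λ b → δ a b * N (n ↑ʳ b) y)
      ≡⟨ cong (c *_) (sum-δ a (λ b → N (n ↑ʳ b) y)) ⟩
    c * N (n ↑ʳ a) y ∎

  ⊗-block-l : ∀ N x j → (N ⊗ block) x (j ↑ˡ m) ≡ sum (λ k → N x (k ↑ˡ m) * P k j)
  ⊗-block-l N x j = begin
    (N ⊗ block) x (j ↑ˡ m)
      ≡⟨ sum-↑ n (λ z → N x z * block z (j ↑ˡ m)) ⟩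
    sum (λ k → N x (k ↑ˡ m) * block (k ↑ˡ m) (j ↑ˡ m)) + sum (λ b → N x (n ↑ʳ b) * block (n ↑ʳ b) (j ↑ˡ m))
      ≡⟨ cong₂ _+_ (sum-cong-≗ (λ k → cong (N x (k ↑ˡ m) *_) (block-ll k j)))
                   (trans (sum-cong-≗ (λ b → ℤₚ.*-comm (N x (n ↑ʳ b)) (block (n ↑ʳ b) (j ↑ˡ m))))
                          (sum-zero (λ b → block (n ↑ʳ b) (j ↑ˡ m)) (λ b → N x (n ↑ʳ b)) (λ b → block-rl b j))) ⟩
    sum (λ k → N x (k ↑ˡ m) * P k j) + 0ℤ
      ≡⟨ ℤₚ.+-identityʳ _ ⟩
    sum (λ k → N x (k ↑ˡ m) * P k j) ∎

  ⊗-block-r : ∀ N x a → (N ⊗ block) x (n ↑ʳ a) ≡ c * N x (n ↑ʳ a)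
  ⊗-block-r N x a = begin
    (N ⊗ block) x (n ↑ʳ a)
      ≡⟨ sum-↑ n (λ z → N x z * block z (n ↑ʳ a)) ⟩
    sum (λ k → N x (k ↑ˡ m) * block (k ↑ˡ m) (n ↑ʳ a)) + sum (λ b → N x (n ↑ʳ b) * block (n ↑ʳ b) (n ↑ʳ a))
      ≡⟨ cong₂ _+_ (trans (sum-cong-≗ (λ k → ℤₚ.*-comm (N x (k ↑ˡ m)) (block (k ↑ˡ m) (n ↑ʳ a))))
                          (sum-zero (λ k → block (k ↑ˡ m) (n ↑ʳ a)) (λ k → N x (k ↑ˡ m)) (λ k → block-lr k a)))
                   (sum-cong-≗ (λ b → trans (cong (N x (n ↑ʳ b) *_) (block-rr b a)) (lemma (N x (n ↑ʳ b)) c (δ b a)))) ⟩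
    0ℤ + sum (λ b → c * N x (n ↑ʳ b) * δ b a)
      ≡⟨ ℤₚ.+-identityˡ _ ⟩
    sum (λ b → c * N x (n ↑ʳ b) * δ b a)
      ≡⟨ sum-δʳ a (λ b → c * N x (n ↑ʳ b)) ⟩
    c * N x (n ↑ʳ a) ∎
    where
    lemma : ∀ a c d → a * (c * d) ≡ c * a * d
    lemma = solve-∀


module Similarity {n m : ℕ} (u : Fin n) (v : Fin (suc m)) (K : Square (suc m)) (P Pᵀ : Square n) (c : ℤ) where

  open Coalescence u v
  open Block {n} {m} P c
  open Block {n} {m} Pᵀ c using () renaming
    (block to blockᵀ; block-⊗-l to blockᵀ-⊗-l; block-⊗-r to blockᵀ-⊗-r; block-lr to blockᵀ-lr)

  coalesce : Square n → Square (n ℕ.+ m)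
  coalesce D x y = D (ρ x) (ρ y) + K (φ x) (φ y)

  block-orthogonal : (∀ i j → (Pᵀ ⊗ P) i j ≡ c * c * δ i j) →
                     ∀ x y → (blockᵀ ⊗ block) x y ≡ c * c * δ x y
  block-orthogonal orthogonal = ↑-elim n _ (λ i → ↑-elim n _ (ll i) (lr i)) (λ a → ↑-elim n _ (rl a) (rr a))
    where
    ll : ∀ i j → (blockᵀ ⊗ block) (i ↑ˡ m) (j ↑ˡ m) ≡ c * c * δ (i ↑ˡ m) (j ↑ˡ m)
    ll i j = begin
      (blockᵀ ⊗ block) (i ↑ˡ m) (j ↑ˡ m)             ≡⟨ blockᵀ-⊗-l block i (j ↑ˡ m) ⟩
      sum (λ k → Pᵀ i k * block (k ↑ˡ m) (j ↑ˡ m))   ≡⟨ sum-cong-≗ (λ k → cong (Pᵀ i k *_) (block-ll k j)) ⟩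
      (Pᵀ ⊗ P) i j                                   ≡⟨ orthogonal i j ⟩
      c * c * δ i j                                  ≡⟨ cong (c * c *_) (δ-ll m i j) ⟨
      c * c * δ (i ↑ˡ m) (j ↑ˡ m)                    ∎
    lr : ∀ i b → (blockᵀ ⊗ block) (i ↑ˡ m) (n ↑ʳ b) ≡ c * c * δ (i ↑ˡ m) (n ↑ʳ b)
    lr i b = begin
      (blockᵀ ⊗ block) (i ↑ˡ m) (n ↑ʳ b)   ≡⟨ ⊗-block-r blockᵀ (i ↑ˡ m) b ⟩
      c * blockᵀ (i ↑ˡ m) (n ↑ʳ b)         ≡⟨ cong (c *_) (blockᵀ-lr i b) ⟩
      c * 0ℤ                               ≡⟨ trans (ℤₚ.*-zeroʳ c) (sym (ℤₚ.*-zeroʳ (c * c))) ⟩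
      c * c * 0ℤ                           ≡⟨ cong (c * c *_) (δ-lr i b) ⟨
      c * c * δ (i ↑ˡ m) (n ↑ʳ b)          ∎
    rl : ∀ a j → (blockᵀ ⊗ block) (n ↑ʳ a) (j ↑ˡ m) ≡ c * c * δ (n ↑ʳ a) (j ↑ˡ m)
    rl a j = begin
      (blockᵀ ⊗ block) (n ↑ʳ a) (j ↑ˡ m)   ≡⟨ blockᵀ-⊗-r block a (j ↑ˡ m) ⟩
      c * block (n ↑ʳ a) (j ↑ˡ m)          ≡⟨ cong (c *_) (block-rl a j) ⟩
      c * 0ℤ                               ≡⟨ trans (ℤₚ.*-zeroʳ c) (sym (ℤₚ.*-zeroʳ (c * c))) ⟩
      c * c * 0ℤ                           ≡⟨ cong (c * c *_) (δ-rl a j) ⟨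
      c * c * δ (n ↑ʳ a) (j ↑ˡ m)          ∎
    rr : ∀ a b → (blockᵀ ⊗ block) (n ↑ʳ a) (n ↑ʳ b) ≡ c * c * δ (n ↑ʳ a) (n ↑ʳ b)
    rr a b = begin
      (blockᵀ ⊗ block) (n ↑ʳ a) (n ↑ʳ b)   ≡⟨ blockᵀ-⊗-r block a (n ↑ʳ b) ⟩
      c * block (n ↑ʳ a) (n ↑ʳ b)          ≡⟨ cong (c *_) (block-rr a b) ⟩
      c * (c * δ a b)                      ≡⟨ ℤₚ.*-assoc c c (δ a b) ⟨
      c * c * δ a b                        ≡⟨ cong (c * c *_) (δ-rr n a b) ⟨
      c * c * δ (n ↑ʳ a) (n ↑ʳ b)          ∎

  module _ (D E : Square n) (intertwines : ∀ i j → (P ⊗ D) i j ≡ (E ⊗ P) i j)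
           (row-sum : ∀ i → sum (P i) ≡ c) (column-sum : ∀ j → sum (λ k → P k j) ≡ c)
           (root-row : ∀ k → P u k ≡ c * δ u k) (root-column : ∀ k → P k u ≡ c * δ k u) where

    -- Between an old vertex and a vertex of `K`, only row or column `u` of the small matrix enters.
    -- There `P` acts as the scalar `c`, like the second block.
    D-from-root : ∀ j → (P ⊗ D) u j ≡ c * D u j
    D-from-root j = begin
      sum (λ k → P u k * D k j)           ≡⟨ sum-cong-≗ (λ k → cong (_* D k j) (root-row k)) ⟩
      sum (λ k → c * δ u k * D k j)       ≡⟨ sum-cong-≗ (λ k → lemma c (δ u k) (D k j)) ⟩
      sum (λ k → δ u k * (c * D k j))     ≡⟨ sum-δ u (λ k → c * D k j) ⟩
      c * D u j                           ∎
      where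
      lemma : ∀ c d a → c * d * a ≡ d * (c * a)
      lemma = solve-∀

    E-to-root : ∀ i → (E ⊗ P) i u ≡ c * E i u
    E-to-root i = begin
      sum (λ k → E i k * P k u)           ≡⟨ sum-cong-≗ (λ k → cong (E i k *_) (root-column k)) ⟩
      sum (λ k → E i k * (c * δ k u))     ≡⟨ sum-cong-≗ (λ k → lemma (E i k) c (δ k u)) ⟩
      sum (λ k → c * E i k * δ k u)       ≡⟨ sum-δʳ u (λ k → c * E i k) ⟩
      c * E i u                           ∎
      where
      lemma : ∀ a c d → a * (c * d) ≡ c * a * d
      lemma = solve-∀

    entry : ∀ M {x y i j a b} → ρ x ≡ i → ρ y ≡ j → φ x ≡ a → φ y ≡ b → coalesce M x y ≡ M i j + K a b
    entry M refl refl refl refl = refl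

    sumˡ : ∀ {n} (f g : Fin n → ℤ) c → sum (λ k → f k * (g k + c)) ≡ sum (λ k → f k * g k) + sum f * c
    sumˡ f g c = begin
      sum (λ k → f k * (g k + c))                   ≡⟨ sum-cong-≗ (λ k → ℤₚ.*-distribˡ-+ (f k) (g k) c) ⟩
      sum (λ k → f k * g k + f k * c)               ≡⟨ ∑-distrib-+ (λ k → f k * g k) (λ k → f k * c) ⟩
      sum (λ k → f k * g k) + sum (λ k → f k * c)   ≡⟨ cong (_+_ (sum (λ k → f k * g k))) (*-distribʳ-sum c f) ⟨
      sum (λ k → f k * g k) + sum f * c             ∎

    sumʳ : ∀ {n} (f g : Fin n → ℤ) c → sum (λ k → (g k + c) * f k) ≡ sum (λ k → g k * f k) + sum f * c
    sumʳ f g c = begin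
      sum (λ k → (g k + c) * f k)         ≡⟨ sum-cong-≗ (λ k → ℤₚ.*-comm (g k + c) (f k)) ⟩
      sum (λ k → f k * (g k + c))         ≡⟨ sumˡ f g c ⟩
      sum (λ k → f k * g k) + sum f * c
        ≡⟨ cong (_+ sum f * c) (sum-cong-≗ (λ k → ℤₚ.*-comm (f k) (g k))) ⟩
      sum (λ k → g k * f k) + sum f * c   ∎

    block-intertwines : ∀ x y → (block ⊗ coalesce D) x y ≡ (coalesce E ⊗ block) x y
    block-intertwines = ↑-elim n _ (λ i → ↑-elim n _ (ll i) (lr i)) (λ a → ↑-elim n _ (rl a) (rr a))
      where
      ll : ∀ i j → (block ⊗ coalesce D) (i ↑ˡ m) (j ↑ˡ m) ≡ (coalesce E ⊗ block) (i ↑ˡ m) (j ↑ˡ m)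
      ll i j = begin
        (block ⊗ coalesce D) (i ↑ˡ m) (j ↑ˡ m)
          ≡⟨ block-⊗-l (coalesce D) i (j ↑ˡ m) ⟩
        sum (λ k → P i k * coalesce D (k ↑ˡ m) (j ↑ˡ m))
          ≡⟨ sum-cong-≗ (λ k → cong (P i k *_) (entry D (ρ-ι k) (ρ-ι j) (φ-ι k) (φ-ι j))) ⟩
        sum (λ k → P i k * (D k j + K v v))
          ≡⟨ sumˡ (P i) (λ k → D k j) (K v v) ⟩
        (P ⊗ D) i j + sum (P i) * K v v
          -- Row sum `i` of `P` equals column sum `j`, so the constant `K v v` passes from the left
          -- of the product to the right.
          ≡⟨ cong₂ (λ a b → a + b * K v v) (intertwines i j) (trans (row-sum i) (sym (column-sum j))) ⟩
        (E ⊗ P) i j + sum (λ k → P k j) * K v v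
          ≡⟨ sumʳ (λ k → P k j) (E i) (K v v) ⟨
        sum (λ k → (E i k + K v v) * P k j)
          ≡⟨ sum-cong-≗ (λ k → cong (_* P k j) (entry E (ρ-ι i) (ρ-ι k) (φ-ι i) (φ-ι k))) ⟨
        sum (λ k → coalesce E (i ↑ˡ m) (k ↑ˡ m) * P k j)
          ≡⟨ ⊗-block-l (coalesce E) (i ↑ˡ m) j ⟨
        (coalesce E ⊗ block) (i ↑ˡ m) (j ↑ˡ m) ∎
      lr : ∀ i b → (block ⊗ coalesce D) (i ↑ˡ m) (n ↑ʳ b) ≡ (coalesce E ⊗ block) (i ↑ˡ m) (n ↑ʳ b)
      lr i b = begin
        (block ⊗ coalesce D) (i ↑ˡ m) (n ↑ʳ b)
          ≡⟨ block-⊗-l (coalesce D) i (n ↑ʳ b) ⟩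
        sum (λ k → P i k * coalesce D (k ↑ˡ m) (n ↑ʳ b))
          ≡⟨ sum-cong-≗ (λ k → cong (P i k *_) (entry D (ρ-ι k) (ρ-κ b) (φ-ι k) (φ-κ b))) ⟩
        sum (λ k → P i k * (D k u + K v w))
          ≡⟨ sumˡ (P i) (λ k → D k u) (K v w) ⟩
        (P ⊗ D) i u + sum (P i) * K v w
          ≡⟨ cong₂ (λ a b → a + b * K v w) (trans (intertwines i u) (E-to-root i)) (row-sum i) ⟩
        c * E i u + c * K v w
          ≡⟨ ℤₚ.*-distribˡ-+ c (E i u) (K v w) ⟨
        c * (E i u + K v w)
          ≡⟨ cong (c *_) (entry E (ρ-ι i) (ρ-κ b) (φ-ι i) (φ-κ b)) ⟨
        c * coalesce E (i ↑ˡ m) (n ↑ʳ b)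
          ≡⟨ ⊗-block-r (coalesce E) (i ↑ˡ m) b ⟨
        (coalesce E ⊗ block) (i ↑ˡ m) (n ↑ʳ b) ∎
        where w = punchIn v b
      rl : ∀ a j → (block ⊗ coalesce D) (n ↑ʳ a) (j ↑ˡ m) ≡ (coalesce E ⊗ block) (n ↑ʳ a) (j ↑ˡ m)
      rl a j = begin
        (block ⊗ coalesce D) (n ↑ʳ a) (j ↑ˡ m)
          ≡⟨ block-⊗-r (coalesce D) a (j ↑ˡ m) ⟩
        c * coalesce D (n ↑ʳ a) (j ↑ˡ m)
          ≡⟨ cong (c *_) (entry D (ρ-κ a) (ρ-ι j) (φ-κ a) (φ-ι j)) ⟩
        c * (D u j + K w v)
          ≡⟨ ℤₚ.*-distribˡ-+ c (D u j) (K w v) ⟩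
        c * D u j + c * K w v
          ≡⟨ cong₂ (λ a b → a + b * K w v) (trans (sym (intertwines u j)) (D-from-root j)) (column-sum j) ⟨
        (E ⊗ P) u j + sum (λ k → P k j) * K w v
          ≡⟨ sumʳ (λ k → P k j) (E u) (K w v) ⟨
        sum (λ k → (E u k + K w v) * P k j)
          ≡⟨ sum-cong-≗ (λ k → cong (_* P k j) (entry E (ρ-κ a) (ρ-ι k) (φ-κ a) (φ-ι k))) ⟨
        sum (λ k → coalesce E (n ↑ʳ a) (k ↑ˡ m) * P k j)
          ≡⟨ ⊗-block-l (coalesce E) (n ↑ʳ a) j ⟨
        (coalesce E ⊗ block) (n ↑ʳ a) (j ↑ˡ m) ∎
        where w = punchIn v a
      rr : ∀ a b → (block ⊗ coalesce D) (n ↑ʳ a) (n ↑ʳ b) ≡ (coalesce E ⊗ block) (n ↑ʳ a) (n ↑ʳ b)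
      rr a b = begin
        (block ⊗ coalesce D) (n ↑ʳ a) (n ↑ʳ b)
          ≡⟨ block-⊗-r (coalesce D) a (n ↑ʳ b) ⟩
        c * coalesce D (n ↑ʳ a) (n ↑ʳ b)
          ≡⟨ cong (c *_) (entry D (ρ-κ a) (ρ-κ b) (φ-κ a) (φ-κ b)) ⟩
        c * (D u u + k)
          ≡⟨ ℤₚ.*-distribˡ-+ c (D u u) k ⟩
        c * D u u + c * k
          -- Reading the intertwining relation at `(u , u)` from both ends gives
          -- `c * D u u ≡ c * E u u`.
          ≡⟨ cong (_+ c * k) (trans (sym (D-from-root u)) (trans (intertwines u u) (E-to-root u))) ⟩
        c * E u u + c * k
          ≡⟨ ℤₚ.*-distribˡ-+ c (E u u) k ⟨
        c * (E u u + k)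
          ≡⟨ cong (c *_) (entry E (ρ-κ a) (ρ-κ b) (φ-κ a) (φ-κ b)) ⟨
        c * coalesce E (n ↑ʳ a) (n ↑ʳ b)
          ≡⟨ ⊗-block-r (coalesce E) (n ↑ʳ a) b ⟨
        (coalesce E ⊗ block) (n ↑ʳ a) (n ↑ʳ b) ∎
        where k = K (punchIn v a) (punchIn v b)

    Det-coalesce : c * c ≢ 0ℤ → (∀ i j → (Pᵀ ⊗ P) i j ≡ c * c * δ i j) → ∀ z →
                   Det (characteristic z (coalesce D)) ≡ Det (characteristic z (coalesce E))
    Det-coalesce c²≢0 orthogonal z =
      Det-intertwined block blockᵀ (characteristic z (coalesce D)) (characteristic z (coalesce E)) (c * c) c²≢0
        (block-orthogonal orthogonal)
        (intertwine-characteristic z block (coalesce D) (coalesce E) block-intertwines)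

casts : ∀ {n} → (Fin n → Fin n → ℕ) → Square n
casts d i j = + d i j

module _ {n m : ℕ} (u : Fin n) (v : Fin (suc m)) (P Pᵀ : Square n) (c : ℤ) (c²≢0 : c * c ≢ 0ℤ)
         (orthogonal : ∀ i j → (Pᵀ ⊗ P) i j ≡ c * c * δ i j) (d e : Fin n → Fin n → ℕ)
         (intertwines : ∀ i j → (P ⊗ casts d) i j ≡ (casts e ⊗ P) i j)
         (row-sum : ∀ i → sum (P i) ≡ c) (column-sum : ∀ j → sum (λ k → P k j) ≡ c)
         (root-row : ∀ k → P u k ≡ c * δ u k) (root-column : ∀ k → P k u ≡ c * δ k u) where

  open Coalescence {n} {m} u v using (ρ; φ)

  charPoly-coalesce : ∀ (dK : Fin (suc m) → Fin (suc m) → ℕ) (D E : Fin (n ℕ.+ m) → Fin (n ℕ.+ m) → ℕ) →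
                      (∀ x y → D x y ≡ d (ρ x) (ρ y) ℕ.+ dK (φ x) (φ y)) →
                      (∀ x y → E x y ≡ e (ρ x) (ρ y) ℕ.+ dK (φ x) (φ y)) →
                      charPoly D ≈P charPoly E
  charPoly-coalesce dK D E D≡ E≡ = eval-injective (charPoly D) (charPoly E) λ z → begin
    eval z (charPoly D)                            ≡⟨ eval-charPoly z D ⟩
    Det (characteristic z (casts D))               ≡⟨ Det-cong (λ x y → cong (λ a → z * δ x y - + a) (D≡ x y)) ⟩
    Det (characteristic z (coalesce (casts d)))
      ≡⟨ Det-coalesce (casts d) (casts e) intertwines row-sum column-sum root-row root-column c²≢0 orthogonal z ⟩
    Det (characteristic z (coalesce (casts e)))    ≡⟨ Det-cong (λ x y → cong (λ a → z * δ x y - + a) (E≡ x y)) ⟨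
    Det (characteristic z (casts E))               ≡⟨ eval-charPoly z E ⟨
    eval z (charPoly E)                            ∎
    where open Similarity u v (casts dK) P Pᵀ c

-- The matrix S

-- Up to the factor 7, an orthogonal matrix.  The linear conditions below leave
-- a one-parameter family of rational solutions, two of which are orthogonal.
S Sᵀ : Square 10
S i j = lookup (lookup rows i) j
  where
  rows : Vec (Vec ℤ 10) 10
  rows =
    ( (+ 7 ∷ + 0 ∷ + 0 ∷ + 0 ∷ + 0 ∷ + 0 ∷ + 0 ∷ + 0 ∷ + 0 ∷ + 0 ∷ [])
    ∷ (+ 0 ∷ + 7 ∷ + 0 ∷ + 0 ∷ + 0 ∷ + 0 ∷ + 0 ∷ + 0 ∷ + 0 ∷ + 0 ∷ [])
    ∷ (+ 0 ∷ + 0 ∷ + 5 ∷ - + 1 ∷ + 2 ∷ + 3 ∷ + 2 ∷ - + 1 ∷ - + 1 ∷ - + 2 ∷ [])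
    ∷ (+ 0 ∷ + 0 ∷ + 1 ∷ + 4 ∷ - + 1 ∷ + 2 ∷ - + 1 ∷ - + 3 ∷ + 4 ∷ + 1 ∷ [])
    ∷ (+ 0 ∷ + 0 ∷ + 2 ∷ + 1 ∷ + 5 ∷ - + 3 ∷ - + 2 ∷ + 1 ∷ + 1 ∷ + 2 ∷ [])
    ∷ (+ 0 ∷ + 0 ∷ + 1 ∷ + 4 ∷ - + 1 ∷ + 2 ∷ - + 1 ∷ + 4 ∷ - + 3 ∷ + 1 ∷ [])
    ∷ (+ 0 ∷ + 0 ∷ + 2 ∷ + 1 ∷ - + 2 ∷ - + 3 ∷ + 5 ∷ + 1 ∷ + 1 ∷ + 2 ∷ [])
    ∷ (+ 0 ∷ + 0 ∷ + 1 ∷ - + 3 ∷ - + 1 ∷ + 2 ∷ - + 1 ∷ + 4 ∷ + 4 ∷ + 1 ∷ [])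
    ∷ (+ 0 ∷ + 0 ∷ - + 3 ∷ + 2 ∷ + 3 ∷ + 1 ∷ + 3 ∷ + 2 ∷ + 2 ∷ - + 3 ∷ [])
    ∷ (+ 0 ∷ + 0 ∷ - + 2 ∷ - + 1 ∷ + 2 ∷ + 3 ∷ + 2 ∷ - + 1 ∷ - + 1 ∷ + 5 ∷ [])
    ∷ [])
Sᵀ i j = S j i

S-orthogonal : ∀ i j → (Sᵀ ⊗ S) i j ≡ + 7 * + 7 * δ i j
S-orthogonal = from-yes (all? λ i → all? λ j → (Sᵀ ⊗ S) i j ℤ.≟ + 7 * + 7 * δ i j)

S-intertwines : ∀ i j → (S ⊗ casts dG) i j ≡ (casts dH ⊗ S) i j
S-intertwines = from-yes (all? λ i → all? λ j → (S ⊗ casts dG) i j ℤ.≟ (casts dH ⊗ S) i j)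

S-row-sum : ∀ i → sum (S i) ≡ + 7
S-row-sum = from-yes (all? λ i → sum (S i) ℤ.≟ + 7)

S-column-sum : ∀ j → sum (λ k → S k j) ≡ + 7
S-column-sum = from-yes (all? λ j → sum (λ k → S k j) ℤ.≟ + 7)

S-root-row : ∀ (u : Fin 10) → toℕ u < 2 → ∀ k → S u k ≡ + 7 * δ u k
S-root-row = from-yes (all? λ u → (toℕ u ℕ.<? 2) →-dec all? λ k → S u k ℤ.≟ + 7 * δ u k)

S-root-column : ∀ (u : Fin 10) → toℕ u < 2 → ∀ k → S k u ≡ + 7 * δ k u
S-root-column = from-yes (all? λ u → (toℕ u ℕ.<? 2) →-dec all? λ k → S k u ℤ.≟ + 7 * δ k u)

theorem1 : (m : ℕ) (K : Adjacency (suc m)) → SymmetricAdj K → IrreflexiveAdj K →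
    Connected K → (v : Fin (suc m)) (u : Fin 10) → toℕ u < 2 →
    DistanceCospectral (glue G u K v) (glue H u K v)
theorem1 m K _ _ _ v u u<2 DA DB isDA isDB =
  charPoly-coalesce u v S Sᵀ (+ 7) (λ ()) S-orthogonal dG dH S-intertwines S-row-sum S-column-sum
    (S-root-row u u<2) (S-root-column u u<2) dK DA DB
    (Glue.glue-distance G u K v isDA dG-distance isdK) (Glue.glue-distance H u K v isDB dH-distance isdK)
  where
  dK : Fin (suc m) → Fin (suc m) → ℕ
  -- The distances of `K` are read off the coalescence with `G`; being those of `K` itself, they
  -- serve for `H` too.
  dK x y = DA (Coalescence.ψ u v x) (Coalescence.ψ u v y)
  isdK : IsDistanceMatrix K dK
  isdK = Glue.factor-distance G u K v isDA
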